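{- Let $k,l\ge2$, $n,m\ge1$ be integers, $\alpha>0$, and suppose $f=(f_1,\dots,f_m):[k]^n\to[l]^m$ is $\alpha$-Lipschitz with respect to the $L^1$-norm. Then for any $\delta,\epsilon>0$, there are at least $(1-\delta)m$ coordinates $i\in[m]$ such that $f_i$ is $\epsilon$-close to some $M$-junta $g_i:[k]^n\to[l]$, where $$M\le (l-1)\exp\!\left(\frac{C_3\alpha k}{\delta\epsilon}\right)$$ and $C_3$ is an absolute constant.
   Context: $[k]=\{1,\dots,k\}$. For $x\in[k]^n$ (viewed in $\mathbb{R}^n$), $\|x\|_1=\frac1n\sum_{i=1}^n|x_i|$; for $y\in[l]^m$, $\|y\|_1=\frac1m\sum_{i=1}^m|y_i|$. $f$ is $\alpha$-Lipschitz with respect to the $L^1$-norm if $\|f(x)-f(y)\|_1\le\alpha\|x-y\|_1$ for all $x,y\in[k]^n$. Two functions $h,\tilde h:[k]^n\to[l]$ are $\epsilon$-close if $k^{ -n}\sum_{x\in[k]^n}|h(x)-\tilde h(x)|\le\epsilon$. A function $g$ on $[k]^n$ is an $M$-junta if there is $J\subset[n]$ with $|J|=M$ such that $g(x)$ depends only on $(x_j)_{j\in J}$. -}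

module Defs where

open import Data.Nat as ℕ using (ℕ; zero; suc; NonZero; _!)
open import Data.Nat.Properties using (m^n≢0; _!≢0)
open import Data.Integer using (+_)
open import Data.Rational using (ℚ; 0ℚ; 1ℚ; _+_; _*_; _-_; _/_; ∣_∣; _≤_; _<_)
open import Data.Fin as F using (Fin; toℕ)
open import Data.Fin.Subset using (Subset; _∈_) renaming (∣_∣ to size)
open import Data.Vec.Functional using (_∷_)
open import Data.Product using (Σ; _×_; ∃)
open import Relation.Binary.PropositionalEquality using (_≡_)

ι : ℕ → ℚ
ι n = + n / 1

-- value of an element of [k] (encoded as Fin k, i.e. shifted by -1; irrelevant
-- since only differences of values ever occur)
val : ∀ {k} → Fin k → ℚ
val a = ι (toℕ a)

Cube : ℕ → ℕ → Set
Cube k n = Fin n → Fin k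

sumFin : (n : ℕ) → (Fin n → ℚ) → ℚ
sumFin zero    F = 0ℚ
sumFin (suc n) G = G F.zero + sumFin n (λ i → G (F.suc i))

sumCube : (k n : ℕ) → (Cube k n → ℚ) → ℚ
sumCube k zero    F = F (λ ())
sumCube k (suc n) F = sumFin k (λ a → sumCube k n (λ x → F (a ∷ x)))

dist₁ : ∀ {k} (n : ℕ) .{{_ : NonZero n}} → Cube k n → Cube k n → ℚ
dist₁ n x y = (+ 1 / n) * sumFin n (λ i → ∣ val (x i) - val (y i) ∣)

Lipschitz : ∀ {k l} (n m : ℕ) .{{_ : NonZero n}} .{{_ : NonZero m}} →
            ℚ → (Cube k n → Cube l m) → Set
Lipschitz n m α f = ∀ x y → dist₁ m (f x) (f y) ≤ α * dist₁ n x y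

Close : ∀ {l} (k n : ℕ) .{{_ : NonZero k}} → ℚ → (Cube k n → Fin l) → (Cube k n → Fin l) → Set
Close {l} k n ε h h' =
  (+ 1 / (k ℕ.^ n)) {{nz}} * sumCube k n (λ x → ∣ val (h x) - val (h' x) ∣) ≤ ε
  where
  nz : NonZero (k ℕ.^ n)
  nz = m^n≢0 k n

Junta : ∀ {k l n} → ℕ → (Cube k n → Fin l) → Set
Junta {k} {l} {n} M g =
  Σ (Subset n) λ J → size J ≡ M ×
    (∀ x y → (∀ j → j ∈ J → x j ≡ y j) → g x ≡ g y)

pow : ℚ → ℕ → ℚ
pow y zero    = 1ℚ
pow y (suc j) = y * pow y j

expPartial : ℚ → ℕ → ℚ
expPartial y zero    = 0ℚ
expPartial y (suc N) = expPartial y N + pow y N * (+ 1 / (N !)) {{N !≢0}}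

-- x ≤ c · exp(y), for y > 0 rational (exp y = sup_N expPartial y N, not attained).
-- For rational y > 0 and natural c ≥ 1, c·exp(y) is irrational, so
-- x ≤ c·exp y  ⇔  x < c·exp y  ⇔  ∃ N. x ≤ c · expPartial y N.
_≤_·exp_ : ℚ → ℚ → ℚ → Set
x ≤ c ·exp y = ∃ λ N → x ≤ c * expPartial y N

{-# OPTIONS --safe #-}

-- The proof is Friedgut's junta argument on the discrete cube, transported to [k]ⁿ. Map s bits
-- monotonically onto [k], so that the uniform measure on bits dominates half of the uniform
-- measure on [k]ⁿ. The bits encoding one coordinate then have total influence at most the total
-- variation along the corresponding line, with no dependence on k, and the Lipschitz condition
-- bounds these variations, summed over lines and averaged over the components of f, by α k. By
-- Markov's inequality all but δ m components have total variation at most B = α k / δ.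
--
-- Such a component is cut into its l - 1 thresholds, which share one junta J: the coordinates
-- along which the component has variation more than 36⁻ᵈ / 2. Bonami's inequality bounds the
-- degree < d part of a threshold outside J by 2⁻ᵈ times its influence, and the part of degree
-- ≥ d is at most influence / d. Rounding the conditional expectations given J to {0,1} costs only
-- a constant factor, and d of order B / ε makes the total error at most ε.
module Submission where

open import Defs
open import Data.Bool using (Bool; true; false; not; if_then_else_)
open import Data.Empty using (⊥-elim)
open import Data.Fin using (Fin; toℕ; _↑ˡ_; _↑ʳ_; combine)
import Data.Fin as F
open import Data.Fin.Properties using (combine-surjective; toℕ-inject₁; toℕ≤pred[n])
open import Data.Fin.Subset using (Subset; _∈_; ⊥) renaming (∣_∣ to size)
open import Data.Fin.Subset.Properties using (∣⊥∣≡0)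
import Data.Integer as ℤ
import Data.Integer.Properties as ℤₚ
open import Data.Nat using (ℕ; zero; suc; NonZero; _≥_; z≤n; s≤s; _!)
import Data.Nat
import Data.Nat as ℕ
open import Data.Nat.DivMod using (m/n*n≤m; m≡m%n+[m/n]*n; m%n<n; m≥n⇒m/n>0)
import Data.Nat.Properties as ℕₚ
open import Data.Product using (Σ; _×_; ∃; _,_; proj₁; proj₂)
open import Data.Rational using (ℚ; mkℚ; 0ℚ; 1ℚ; ½; _+_; _*_; _-_; -_; _/_; 1/_; _÷_; ∣_∣; _≤_; _<_; Positive; nonNegative; positive; fromℚᵘ)
open import Data.Rational.Properties
open import Data.Rational.Solver using (module +-*-Solver)
import Data.Rational.Unnormalised as ℚᵘ
import Data.Rational.Unnormalised.Properties as ℚᵘₚ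
open import Data.Sum using (_⊎_; inj₁; inj₂)
open import Data.Vec using (Vec; []; _∷_; _++_; lookup; replicate; _[_]%=_)
import Data.Vec as V
open import Data.Vec.Functional using () renaming (_∷_ to _∷ᶠ_)
open import Data.Vec.Properties using (take++drop≡id; lookup-++ˡ; lookup-++ʳ; lookup-replicate; []=⇒lookup; lookup⇒[]=)
open import Relation.Binary.PropositionalEquality using (_≡_; refl; sym; trans; cong; cong₂; subst; module ≡-Reasoning)
open import Relation.Nullary using (Dec; does; yes; no)
open +-*-Solver using (solve; _:=_; _:+_; _:*_; _:-_; :-_; con)

-- Rational arithmetic and finite sums

-- Bits replace [k] because Bonami's inequality for uniform bits has a constant free of k. The
-- obstacle is that k need not be a power of two, and a fixed loss of measure in each coordinate
-- would be exponential in n. So the number of bits per coordinate grows with n. This is harmless: a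
-- monotone encoding crosses each edge of a line at most once, so the bound on the influence of a
-- block of bits ignores its length. One-sided domination suffices, since only the nonnegative error
-- is carried back to [k]ⁿ.
--
-- J consists of coordinates of [k]ⁿ, that is of whole blocks, so that the conditional expectation
-- is again a function on [k]ⁿ. Markov's inequality gives |J| ≤ 2 B 36ᵈ, while the claim has the
-- prefactor l - 1 and only B / ε in the exponent. If ε ≥ l - 1, a constant is close enough;
-- otherwise B < (l - 1) B / ε. If B / ε is so small that d = 1, the exponential may be close to 1
-- and this bound on J is too weak; then J is empty and Poincaré's inequality takes over.
--
-- As ℚ has no square roots, norms stay squared and hypercontractivity enters through fourth moments
-- only.

infixl 8 _²
_² : ℚ → ℚ
a ² = a * a

≤-excess : ∀ {a b} r → 0ℚ ≤ r → a + r ≡ b → a ≤ b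
≤-excess {a} r 0≤r refl = subst (_≤ a + r) (+-identityʳ a) (+-monoʳ-≤ a 0≤r)

+-nonNeg : ∀ {a b} → 0ℚ ≤ a → 0ℚ ≤ b → 0ℚ ≤ a + b
+-nonNeg = +-mono-≤

*-monoˡ : ∀ {a b c} → 0ℚ ≤ c → a ≤ b → c * a ≤ c * b
*-monoˡ {c = c} 0≤c = *-monoˡ-≤-nonNeg c {{nonNegative 0≤c}}

*-monoʳ : ∀ {a b c} → 0ℚ ≤ c → a ≤ b → a * c ≤ b * c
*-monoʳ {c = c} 0≤c = *-monoʳ-≤-nonNeg c {{nonNegative 0≤c}}

*-mono : ∀ {a b c d} → 0ℚ ≤ b → 0ℚ ≤ c → a ≤ b → c ≤ d → a * c ≤ b * d
*-mono 0≤b 0≤c a≤b c≤d = ≤-trans (*-monoʳ 0≤c a≤b) (*-monoˡ 0≤b c≤d)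

*-nonNeg : ∀ {a b} → 0ℚ ≤ a → 0ℚ ≤ b → 0ℚ ≤ a * b
*-nonNeg {a} 0≤a 0≤b = subst (_≤ a * _) (*-zeroʳ a) (*-monoˡ 0≤a 0≤b)

≤⇒0≤- : ∀ {a b} → a ≤ b → 0ℚ ≤ b - a
≤⇒0≤- {a} {b} a≤b = subst (_≤ b - a) (+-inverseʳ a) (+-monoˡ-≤ (- a) a≤b)

0≤² : ∀ a → 0ℚ ≤ a ²
0≤² a with ≤-total 0ℚ a
... | inj₁ 0≤a = *-nonNeg 0≤a 0≤a
... | inj₂ a≤0 = subst (0ℚ ≤_) (solve 1 (λ x → (:- x) :* (:- x) := x :* x) refl a) (*-nonNeg 0≤-a 0≤-a)
  where
  0≤-a : 0ℚ ≤ - a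
  0≤-a = neg-antimono-≤ a≤0

²-cancel-≤ : ∀ {a b} → 0ℚ ≤ b → a ² ≤ b ² → a ≤ b
²-cancel-≤ {a} {b} 0≤b a²≤b² with a ≤? b
... | yes a≤b = a≤b
... | no a≰b = ⊥-elim (<-irrefl refl (<-≤-trans b²<a² a²≤b²))
  where
  b<a : b < a
  b<a = ≰⇒> a≰b
  b²<a² : b ² < a ²
  b²<a² = ≤-<-trans (*-monoˡ 0≤b (<⇒≤ b<a)) (*-monoˡ-<-pos a {{positive (≤-<-trans 0≤b b<a)}} b<a)

∣a-b∣≡∣b-a∣ : ∀ a b → ∣ a - b ∣ ≡ ∣ b - a ∣
∣a-b∣≡∣b-a∣ a b = trans (sym (∣-p∣≡∣p∣ (a - b))) (cong ∣_∣ (solve 2 (λ x y → :- (x :- y) := y :- x) refl a b))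

∣a-c∣≤ : ∀ a b c → ∣ a - c ∣ ≤ ∣ a - b ∣ + ∣ b - c ∣
∣a-c∣≤ a b c = subst (λ z → ∣ z ∣ ≤ ∣ a - b ∣ + ∣ b - c ∣)
  (solve 3 (λ x y z → (x :- y) :+ (y :- z) := x :- z) refl a b c) (∣p+q∣≤∣p∣+∣q∣ (a - b) (b - c))

∣a-a∣≡0 : ∀ a → ∣ a - a ∣ ≡ 0ℚ
∣a-a∣≡0 a = cong ∣_∣ (+-inverseʳ a)

fromℚᵘ-homo-+ : ∀ p q → fromℚᵘ (p ℚᵘ.+ q) ≡ fromℚᵘ p + fromℚᵘ q
fromℚᵘ-homo-+ p q = toℚᵘ-injective (ℚᵘₚ.≃-trans (toℚᵘ-fromℚᵘ (p ℚᵘ.+ q)) (ℚᵘₚ.≃-sym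
  (ℚᵘₚ.≃-trans (toℚᵘ-homo-+ (fromℚᵘ p) (fromℚᵘ q)) (ℚᵘₚ.+-cong (toℚᵘ-fromℚᵘ p) (toℚᵘ-fromℚᵘ q)))))

fromℚᵘ-homo-* : ∀ p q → fromℚᵘ (p ℚᵘ.* q) ≡ fromℚᵘ p * fromℚᵘ q
fromℚᵘ-homo-* p q = toℚᵘ-injective (ℚᵘₚ.≃-trans (toℚᵘ-fromℚᵘ (p ℚᵘ.* q)) (ℚᵘₚ.≃-sym
  (ℚᵘₚ.≃-trans (toℚᵘ-homo-* (fromℚᵘ p) (fromℚᵘ q)) (ℚᵘₚ.*-cong (toℚᵘ-fromℚᵘ p) (toℚᵘ-fromℚᵘ q)))))

ι-+ : ∀ m n → ι (m ℕ.+ n) ≡ ι m + ι n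
ι-+ m n = trans (cong (λ z → fromℚᵘ (ℚᵘ.mkℚᵘ z 0)) eq) (fromℚᵘ-homo-+ (ℚᵘ.mkℚᵘ (ℤ.+ m) 0) (ℚᵘ.mkℚᵘ (ℤ.+ n) 0))
  where
  eq : ℤ.+ (m ℕ.+ n) ≡ (ℤ.+ m ℤ.* ℤ.+ 1) ℤ.+ (ℤ.+ n ℤ.* ℤ.+ 1)
  eq = sym (cong₂ ℤ._+_ (ℤₚ.*-identityʳ (ℤ.+ m)) (ℤₚ.*-identityʳ (ℤ.+ n)))

ι-* : ∀ m n → ι (m ℕ.* n) ≡ ι m * ι n
ι-* m n = trans (cong (λ z → fromℚᵘ (ℚᵘ.mkℚᵘ z 0)) (ℤₚ.pos-* m n)) (fromℚᵘ-homo-* (ℚᵘ.mkℚᵘ (ℤ.+ m) 0) (ℚᵘ.mkℚᵘ (ℤ.+ n) 0))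

ι-suc : ∀ n → ι (suc n) ≡ 1ℚ + ι n
ι-suc = ι-+ 1

0≤ι : ∀ n → 0ℚ ≤ ι n
0≤ι zero = ≤-refl
0≤ι (suc n) = subst (0ℚ ≤_) (sym (ι-suc n)) (+-nonNeg (nonNegative⁻¹ 1ℚ) (0≤ι n))

ι-mono : ∀ {m n} → m ℕ.≤ n → ι m ≤ ι n
ι-mono {m} {n} m≤n = ≤-excess (ι (n ℕ.∸ m)) (0≤ι (n ℕ.∸ m)) (trans (sym (ι-+ m (n ℕ.∸ m))) (cong ι (ℕₚ.m+[n∸m]≡n m≤n)))

0<ι : ∀ n .{{_ : NonZero n}} → 0ℚ < ι n
0<ι (suc n) = <-≤-trans (positive⁻¹ 1ℚ) (ι-mono {1} {suc n} (ℕ.s≤s ℕ.z≤n))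

1/n*ι : ∀ n .{{_ : NonZero n}} → (ℤ.+ 1 / n) * ι n ≡ 1ℚ
1/n*ι n@(suc n-1) = trans (sym (fromℚᵘ-homo-* (ℚᵘ.mkℚᵘ (ℤ.+ 1) n-1) (ℚᵘ.mkℚᵘ (ℤ.+ n) 0)))
  (fromℚᵘ-cong {ℚᵘ.mkℚᵘ (ℤ.+ 1) n-1 ℚᵘ.* ℚᵘ.mkℚᵘ (ℤ.+ n) 0} {ℚᵘ.1ℚᵘ} (ℚᵘ.*≡* eq))
  where
  eq : (ℤ.+ 1 ℤ.* ℤ.+ n) ℤ.* ℤ.+ 1 ≡ ℤ.+ 1 ℤ.* (ℤ.+ (n ℕ.* 1))
  eq = trans (ℤₚ.*-identityʳ (ℤ.+ 1 ℤ.* ℤ.+ n)) (cong (λ z → ℤ.+ 1 ℤ.* ℤ.+ z) (sym (ℕₚ.*-identityʳ n)))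

0≤1/n : ∀ n .{{_ : NonZero n}} → 0ℚ ≤ ℤ.+ 1 / n
0≤1/n n = *-cancelʳ-≤-pos (ι n) {{positive (0<ι n)}}
  (subst (_≤ (ℤ.+ 1 / n) * ι n) (sym (*-zeroˡ (ι n))) (subst (0ℚ ≤_) (sym (1/n*ι n)) (nonNegative⁻¹ 1ℚ)))

pow-nonNeg : ∀ {y} → 0ℚ ≤ y → ∀ n → 0ℚ ≤ pow y n
pow-nonNeg 0≤y zero = nonNegative⁻¹ 1ℚ
pow-nonNeg 0≤y (suc n) = *-nonNeg 0≤y (pow-nonNeg 0≤y n)

1≤pow : ∀ {y} → 1ℚ ≤ y → ∀ n → 1ℚ ≤ pow y n
1≤pow 1≤y zero = ≤-refl
1≤pow 1≤y (suc n) = *-mono (≤-trans (nonNegative⁻¹ 1ℚ) 1≤y) (nonNegative⁻¹ 1ℚ) 1≤y (1≤pow 1≤y n)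

pow-* : ∀ x y n → pow (x * y) n ≡ pow x n * pow y n
pow-* x y zero = refl
pow-* x y (suc n) = trans (cong (x * y *_) (pow-* x y n))
  (solve 4 (λ x y p q → x :* y :* (p :* q) := x :* p :* (y :* q)) refl x y (pow x n) (pow y n))

ι-^ : ∀ k n → ι (k ℕ.^ n) ≡ pow (ι k) n
ι-^ k zero = refl
ι-^ k (suc n) = trans (ι-* k (k ℕ.^ n)) (cong (ι k *_) (ι-^ k n))

sumFin-cong : ∀ n {f g : Fin n → ℚ} → (∀ i → f i ≡ g i) → sumFin n f ≡ sumFin n g
sumFin-cong zero eq = refl
sumFin-cong (suc n) eq = cong₂ _+_ (eq F.zero) (sumFin-cong n (λ i → eq (F.suc i)))

sumFin-mono : ∀ n {f g : Fin n → ℚ} → (∀ i → f i ≤ g i) → sumFin n f ≤ sumFin n g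
sumFin-mono zero le = ≤-refl
sumFin-mono (suc n) le = +-mono-≤ (le F.zero) (sumFin-mono n (λ i → le (F.suc i)))

sumFin-+ : ∀ n (f g : Fin n → ℚ) → sumFin n (λ i → f i + g i) ≡ sumFin n f + sumFin n g
sumFin-+ zero f g = refl
sumFin-+ (suc n) f g = trans (cong (f F.zero + g F.zero +_) (sumFin-+ n (λ i → f (F.suc i)) (λ i → g (F.suc i))))
  (solve 4 (λ a b x y → a :+ b :+ (x :+ y) := a :+ x :+ (b :+ y)) refl (f F.zero) (g F.zero) _ _)

sumFin-* : ∀ n c (f : Fin n → ℚ) → sumFin n (λ i → c * f i) ≡ c * sumFin n f
sumFin-* zero c f = sym (*-zeroʳ c)
sumFin-* (suc n) c f = trans (cong (c * f F.zero +_) (sumFin-* n c (λ i → f (F.suc i)))) (sym (*-distribˡ-+ c _ _))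

sumFin-const : ∀ n c → sumFin n (λ _ → c) ≡ ι n * c
sumFin-const zero c = sym (*-zeroˡ c)
sumFin-const (suc n) c = trans (cong (c +_) (sumFin-const n c))
  (trans (solve 2 (λ c x → c :+ x :* c := (con 1ℚ :+ x) :* c) refl c (ι n)) (cong (_* c) (sym (ι-suc n))))

sumFin-nonNeg : ∀ n {f : Fin n → ℚ} → (∀ i → 0ℚ ≤ f i) → 0ℚ ≤ sumFin n f
sumFin-nonNeg zero le = ≤-refl
sumFin-nonNeg (suc n) le = +-nonNeg (le F.zero) (sumFin-nonNeg n (λ i → le (F.suc i)))

sumFin-zero : ∀ n {f : Fin n → ℚ} → (∀ i → f i ≡ 0ℚ) → sumFin n f ≡ 0ℚ
sumFin-zero n eq = trans (sumFin-cong n eq) (trans (sumFin-const n 0ℚ) (*-zeroʳ (ι n)))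

sumFin-comm : ∀ m n (f : Fin m → Fin n → ℚ) →
  sumFin m (λ i → sumFin n (f i)) ≡ sumFin n (λ j → sumFin m (λ i → f i j))
sumFin-comm zero n f = sym (sumFin-zero n (λ _ → refl))
sumFin-comm (suc m) n f = trans (cong (sumFin n (f F.zero) +_) (sumFin-comm m n (λ i → f (F.suc i))))
  (sym (sumFin-+ n (f F.zero) (λ j → sumFin m (λ i → f (F.suc i) j))))

term≤sumFin : ∀ n {f : Fin n → ℚ} → (∀ i → 0ℚ ≤ f i) → ∀ i → f i ≤ sumFin n f
term≤sumFin (suc n) {f} le F.zero = ≤-excess _ (sumFin-nonNeg n (λ i → le (F.suc i))) refl
term≤sumFin (suc n) {f} le (F.suc i) = ≤-trans (term≤sumFin n (λ i → le (F.suc i)) i)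
  (≤-excess (f F.zero) (le F.zero) (+-comm _ (f F.zero)))

∣sumFin∣≤ : ∀ n (f : Fin n → ℚ) → ∣ sumFin n f ∣ ≤ sumFin n (λ i → ∣ f i ∣)
∣sumFin∣≤ zero f = ≤-refl
∣sumFin∣≤ (suc n) f = ≤-trans (∣p+q∣≤∣p∣+∣q∣ (f F.zero) _) (+-monoʳ-≤ ∣ f F.zero ∣ (∣sumFin∣≤ n (λ i → f (F.suc i))))

sumFin-↑ : ∀ m n (f : Fin (m ℕ.+ n) → ℚ) →
  sumFin (m ℕ.+ n) f ≡ sumFin m (λ i → f (i ↑ˡ n)) + sumFin n (λ j → f (m ↑ʳ j))
sumFin-↑ zero n f = sym (+-identityˡ (sumFin n f))
sumFin-↑ (suc m) n f = trans (cong (f F.zero +_) (sumFin-↑ m n (λ i → f (F.suc i)))) (sym (+-assoc (f F.zero) _ _))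

sumFin-combine : ∀ n s (f : Fin (n ℕ.* s) → ℚ) →
  sumFin (n ℕ.* s) f ≡ sumFin n (λ i → sumFin s (λ r → f (combine i r)))
sumFin-combine zero s f = refl
sumFin-combine (suc n) s f = trans (sumFin-↑ s (n ℕ.* s) f)
  (cong (sumFin s (λ r → f (r ↑ˡ (n ℕ.* s))) +_) (sumFin-combine n s (λ j → f (s ↑ʳ j))))

-- Analysis on the discrete cube

Fun : ℕ → Set
Fun N = Vec Bool N → ℚ

𝔼 : ∀ N → Fun N → ℚ
𝔼 zero f = f []
𝔼 (suc N) f = ½ * (𝔼 N (λ v → f (false ∷ v)) + 𝔼 N (λ v → f (true ∷ v)))

0≤½ : 0ℚ ≤ ½
0≤½ = nonNegative⁻¹ ½

𝔼-cong : ∀ N {f g : Fun N} → (∀ v → f v ≡ g v) → 𝔼 N f ≡ 𝔼 N g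
𝔼-cong zero eq = eq []
𝔼-cong (suc N) eq = cong₂ (λ a b → ½ * (a + b)) (𝔼-cong N (λ v → eq (false ∷ v))) (𝔼-cong N (λ v → eq (true ∷ v)))

𝔼-mono : ∀ N {f g : Fun N} → (∀ v → f v ≤ g v) → 𝔼 N f ≤ 𝔼 N g
𝔼-mono zero le = le []
𝔼-mono (suc N) le = *-monoˡ 0≤½ (+-mono-≤ (𝔼-mono N (λ v → le (false ∷ v))) (𝔼-mono N (λ v → le (true ∷ v))))

𝔼-const : ∀ N c → 𝔼 N (λ _ → c) ≡ c
𝔼-const zero c = refl
𝔼-const (suc N) c = trans (cong (λ a → ½ * (a + a)) (𝔼-const N c)) (solve 1 (λ x → con ½ :* (x :+ x) := x) refl c)

𝔼-nonNeg : ∀ N {f : Fun N} → (∀ v → 0ℚ ≤ f v) → 0ℚ ≤ 𝔼 N f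
𝔼-nonNeg N {f} le = subst (_≤ 𝔼 N f) (𝔼-const N 0ℚ) (𝔼-mono N le)

𝔼-+ : ∀ N (f g : Fun N) → 𝔼 N (λ v → f v + g v) ≡ 𝔼 N f + 𝔼 N g
𝔼-+ zero f g = refl
𝔼-+ (suc N) f g = trans
  (cong₂ (λ a b → ½ * (a + b)) (𝔼-+ N (λ v → f (false ∷ v)) (λ v → g (false ∷ v))) (𝔼-+ N (λ v → f (true ∷ v)) (λ v → g (true ∷ v))))
  (solve 4 (λ a b x y → con ½ :* (a :+ b :+ (x :+ y)) := con ½ :* (a :+ x) :+ con ½ :* (b :+ y)) refl
    (𝔼 N (λ v → f (false ∷ v))) (𝔼 N (λ v → g (false ∷ v))) (𝔼 N (λ v → f (true ∷ v))) (𝔼 N (λ v → g (true ∷ v))))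

𝔼-* : ∀ N c (f : Fun N) → 𝔼 N (λ v → c * f v) ≡ c * 𝔼 N f
𝔼-* zero c f = refl
𝔼-* (suc N) c f = trans
  (cong₂ (λ a b → ½ * (a + b)) (𝔼-* N c (λ v → f (false ∷ v))) (𝔼-* N c (λ v → f (true ∷ v))))
  (solve 3 (λ c a b → con ½ :* (c :* a :+ c :* b) := c :* (con ½ :* (a :+ b))) refl c (𝔼 N (λ v → f (false ∷ v))) (𝔼 N (λ v → f (true ∷ v))))

𝔼-sumFin : ∀ N n (f : Fin n → Fun N) → 𝔼 N (λ v → sumFin n (λ i → f i v)) ≡ sumFin n (λ i → 𝔼 N (f i))
𝔼-sumFin N zero f = 𝔼-const N 0ℚ
𝔼-sumFin N (suc n) f = trans (𝔼-+ N (f F.zero) _) (cong (𝔼 N (f F.zero) +_) (𝔼-sumFin N n (λ i → f (F.suc i))))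

𝔼-comm : ∀ M N (f : Vec Bool M → Fun N) → 𝔼 M (λ u → 𝔼 N (f u)) ≡ 𝔼 N (λ v → 𝔼 M (λ u → f u v))
𝔼-comm zero N f = refl
𝔼-comm (suc M) N f = trans
  (cong₂ (λ a b → ½ * (a + b)) (𝔼-comm M N (λ u → f (false ∷ u))) (𝔼-comm M N (λ u → f (true ∷ u))))
  (trans (cong (½ *_) (sym (𝔼-+ N _ _))) (sym (𝔼-* N ½ _)))

𝔼-++ : ∀ M N (f : Fun (M ℕ.+ N)) → 𝔼 (M ℕ.+ N) f ≡ 𝔼 M (λ u → 𝔼 N (λ v → f (u V.++ v)))
𝔼-++ zero N f = refl
𝔼-++ (suc M) N f = cong₂ (λ a b → ½ * (a + b)) (𝔼-++ M N (λ w → f (false ∷ w))) (𝔼-++ M N (λ w → f (true ∷ w)))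

⟨_,_⟩ : ∀ {N} → Fun N → Fun N → ℚ
⟨_,_⟩ {N} f g = 𝔼 N (λ v → f v * g v)

‖_‖² : ∀ {N} → Fun N → ℚ
‖ f ‖² = ⟨ f , f ⟩

infixl 6 _⊖_
_⊖_ : ∀ {N} → Fun N → Fun N → Fun N
(f ⊖ g) v = f v - g v

0≤‖‖² : ∀ {N} (f : Fun N) → 0ℚ ≤ ‖ f ‖²
0≤‖‖² {N} f = 𝔼-nonNeg N (λ v → 0≤² (f v))

‖‖²-cong : ∀ {N} {f g : Fun N} → (∀ v → f v ≡ g v) → ‖ f ‖² ≡ ‖ g ‖²
‖‖²-cong {N} eq = 𝔼-cong N (λ v → cong _² (eq v))

-- Induction on the bits. Averaging over the first bit leaves a two-term Cauchy-Schwarz inequality,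
-- whose cross term follows from (2xy)² ≤ 4 ac·bd ≤ (ad + bc)².
cauchy-schwarz : ∀ {N} (f g : Fun N) → ⟨ f , g ⟩ ² ≤ ‖ f ‖² * ‖ g ‖²
cauchy-schwarz {zero} f g = ≤-reflexive (solve 2 (λ x y → x :* y :* (x :* y) := x :* x :* (y :* y)) refl (f []) (g []))
cauchy-schwarz {suc N} f g = lemma ⟨ f₀ , g₀ ⟩ ⟨ f₁ , g₁ ⟩ (0≤‖‖² f₀) (0≤‖‖² f₁) (0≤‖‖² g₀) (0≤‖‖² g₁) (cauchy-schwarz f₀ g₀) (cauchy-schwarz f₁ g₁)
  where
  f₀ f₁ g₀ g₁ : Fun N
  f₀ v = f (false ∷ v)
  f₁ v = f (true ∷ v)
  g₀ v = g (false ∷ v)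
  g₁ v = g (true ∷ v)
  lemma : ∀ x y {a b c d} → 0ℚ ≤ a → 0ℚ ≤ b → 0ℚ ≤ c → 0ℚ ≤ d → x ² ≤ a * c → y ² ≤ b * d →
    (½ * (x + y)) ² ≤ ½ * (a + b) * (½ * (c + d))
  lemma x y {a} {b} {c} {d} 0≤a 0≤b 0≤c 0≤d x²≤ y²≤ =
    ≤-excess (½ * ½ * ((a * c - x ²) + (b * d - y ²) + (a * d + b * c - (x * y + x * y))))
      (*-nonNeg (*-nonNeg 0≤½ 0≤½) (+-nonNeg (+-nonNeg (≤⇒0≤- x²≤) (≤⇒0≤- y²≤)) (≤⇒0≤- 2xy≤)))
      (solve 6 (λ x y a b c d → con ½ :* (x :+ y) :* (con ½ :* (x :+ y)) :+
        con ½ :* con ½ :* ((a :* c :- x :* x) :+ (b :* d :- y :* y) :+ (a :* d :+ b :* c :- (x :* y :+ x :* y)))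
        := con ½ :* (a :+ b) :* (con ½ :* (c :+ d))) refl x y a b c d)
    where
    2xy≤ : x * y + x * y ≤ a * d + b * c
    2xy≤ = ²-cancel-≤ (+-nonNeg (*-nonNeg 0≤a 0≤d) (*-nonNeg 0≤b 0≤c))
      (≤-trans
        (≤-excess ((1ℚ + 1ℚ + 1ℚ + 1ℚ) * (a * c * (b * d) - x ² * y ²))
          (*-nonNeg (nonNegative⁻¹ _) (≤⇒0≤- (*-mono (*-nonNeg 0≤a 0≤c) (0≤² y) x²≤ y²≤)))
          (solve 6 (λ x y a b c d → (x :* y :+ x :* y) :* (x :* y :+ x :* y) :+ con (1ℚ + 1ℚ + 1ℚ + 1ℚ) :* (a :* c :* (b :* d) :- x :* x :* (y :* y))
            := con (1ℚ + 1ℚ + 1ℚ + 1ℚ) :* (a :* c :* (b :* d))) refl x y a b c d))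
        (≤-excess ((a * d - b * c) ²) (0≤² (a * d - b * c))
          (solve 4 (λ a b c d → con (1ℚ + 1ℚ + 1ℚ + 1ℚ) :* (a :* c :* (b :* d)) :+ (a :* d :- b :* c) :* (a :* d :- b :* c)
            := (a :* d :+ b :* c) :* (a :* d :+ b :* c)) refl a b c d)))

-- The Walsh expansion in the first bit: `f (x ∷ v)` is `avg f v + sgn x * dif f v`. Thus `dif`
-- carries the coefficients of the sets containing the first bit and `avg` the others.
avg dif : ∀ {N} → Fun (suc N) → Fun N
avg f v = ½ * (f (false ∷ v) + f (true ∷ v))
dif f v = ½ * (f (false ∷ v) - f (true ∷ v))

sgn : Bool → ℚ
sgn false = 1ℚ
sgn true = - 1ℚ

-- Parseval's identity in one bit. It drives the inductions below, which replace explicit Walsh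
-- coefficients.
⟨⟩-split : ∀ {N} (f g : Fun (suc N)) → ⟨ f , g ⟩ ≡ ⟨ avg f , avg g ⟩ + ⟨ dif f , dif g ⟩
⟨⟩-split {N} f g = trans (cong (½ *_) (sym (𝔼-+ N _ _))) (trans (sym (𝔼-* N ½ _)) (trans (𝔼-cong N pt) (𝔼-+ N _ _)))
  where
  pt : ∀ v → ½ * (f (false ∷ v) * g (false ∷ v) + f (true ∷ v) * g (true ∷ v)) ≡ avg f v * avg g v + dif f v * dif g v
  pt v = solve 4 (λ a b x y → con ½ :* (a :* x :+ b :* y) :=
    con ½ :* (a :+ b) :* (con ½ :* (x :+ y)) :+ con ½ :* (a :- b) :* (con ½ :* (x :- y))) refl
    (f (false ∷ v)) (f (true ∷ v)) (g (false ∷ v)) (g (true ∷ v))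

‖‖²-split : ∀ {N} (h : Fun (suc N)) (p q : Fun N) → (∀ v → avg h v ≡ p v) → (∀ v → dif h v ≡ q v) →
  ‖ h ‖² ≡ ‖ p ‖² + ‖ q ‖²
‖‖²-split h p q eqp eqq = trans (⟨⟩-split h h) (cong₂ _+_ (‖‖²-cong eqp) (‖‖²-cong eqq))

avg-cong : ∀ {N} {f g : Fun (suc N)} → (∀ v → f v ≡ g v) → ∀ v → avg f v ≡ avg g v
avg-cong eq v = cong₂ (λ a b → ½ * (a + b)) (eq (false ∷ v)) (eq (true ∷ v))

dif-cong : ∀ {N} {f g : Fun (suc N)} → (∀ v → f v ≡ g v) → ∀ v → dif f v ≡ dif g v
dif-cong eq v = cong₂ (λ a b → ½ * (a - b)) (eq (false ∷ v)) (eq (true ∷ v))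

avg-⊖ : ∀ {N} (f g : Fun (suc N)) v → avg (f ⊖ g) v ≡ avg f v - avg g v
avg-⊖ f g v = solve 4 (λ a b x y → con ½ :* ((a :- x) :+ (b :- y)) := con ½ :* (a :+ b) :- con ½ :* (x :+ y)) refl
  (f (false ∷ v)) (f (true ∷ v)) (g (false ∷ v)) (g (true ∷ v))

dif-⊖ : ∀ {N} (f g : Fun (suc N)) v → dif (f ⊖ g) v ≡ dif f v - dif g v
dif-⊖ f g v = solve 4 (λ a b x y → con ½ :* ((a :- x) :- (b :- y)) := con ½ :* (a :- b) :- con ½ :* (x :- y)) refl
  (f (false ∷ v)) (f (true ∷ v)) (g (false ∷ v)) (g (true ∷ v))

-- Projection onto the Walsh polynomials of degree less than d.
proj : ∀ {N} → ℕ → Fun N → Fun N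
proj zero f v = 0ℚ
proj (suc d) f [] = f []
proj (suc d) f (x ∷ v) = proj (suc d) (avg f) v + sgn x * proj d (dif f) v

proj-cong : ∀ {N} d {f g : Fun N} → (∀ v → f v ≡ g v) → ∀ v → proj d f v ≡ proj d g v
proj-cong zero eq v = refl
proj-cong (suc d) eq [] = eq []
proj-cong (suc d) eq (x ∷ v) = cong₂ (λ a b → a + sgn x * b) (proj-cong (suc d) (avg-cong eq) v) (proj-cong d (dif-cong eq) v)

avg-proj : ∀ {N} d (f : Fun (suc N)) v → avg (proj (suc d) f) v ≡ proj (suc d) (avg f) v
avg-proj d f v = solve 2 (λ p q → con ½ :* (p :+ con 1ℚ :* q :+ (p :+ con (- 1ℚ) :* q)) := p) refl (proj (suc d) (avg f) v) (proj d (dif f) v)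

dif-proj : ∀ {N} d (f : Fun (suc N)) v → dif (proj (suc d) f) v ≡ proj d (dif f) v
dif-proj d f v = solve 2 (λ p q → con ½ :* (p :+ con 1ℚ :* q :- (p :+ con (- 1ℚ) :* q)) := q) refl (proj (suc d) (avg f) v) (proj d (dif f) v)

‖proj‖²-split : ∀ {N} d (f : Fun (suc N)) → ‖ proj (suc d) f ‖² ≡ ‖ proj (suc d) (avg f) ‖² + ‖ proj d (dif f) ‖²
‖proj‖²-split d f = ‖‖²-split (proj (suc d) f) (proj (suc d) (avg f)) (proj d (dif f)) (avg-proj d f) (dif-proj d f)

‖⊖proj‖²-split : ∀ {N} d (f : Fun (suc N)) →
  ‖ f ⊖ proj (suc d) f ‖² ≡ ‖ avg f ⊖ proj (suc d) (avg f) ‖² + ‖ dif f ⊖ proj d (dif f) ‖²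
‖⊖proj‖²-split d f = ‖‖²-split (f ⊖ proj (suc d) f) (avg f ⊖ proj (suc d) (avg f)) (dif f ⊖ proj d (dif f))
  (λ v → trans (avg-⊖ f (proj (suc d) f) v) (cong (λ z → avg f v - z) (avg-proj d f v)))
  (λ v → trans (dif-⊖ f (proj (suc d) f) v) (cong (λ z → dif f v - z) (dif-proj d f v)))

𝔼-zero : ∀ N {f : Fun N} → (∀ v → f v ≡ 0ℚ) → 𝔼 N f ≡ 0ℚ
𝔼-zero N eq = trans (𝔼-cong N eq) (𝔼-const N 0ℚ)

proj-orthogonal : ∀ {N} d (f : Fun N) → ⟨ proj d f , f ⟩ ≡ ‖ proj d f ‖²
proj-orthogonal {N} zero f = trans (𝔼-zero N (λ v → *-zeroˡ (f v))) (sym (𝔼-zero N (λ v → refl)))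
proj-orthogonal {zero} (suc d) f = refl
proj-orthogonal {suc N} (suc d) f = trans (⟨⟩-split (proj (suc d) f) f) (trans
  (cong₂ _+_
    (trans (𝔼-cong N (λ v → cong (_* avg f v) (avg-proj d f v))) (proj-orthogonal (suc d) (avg f)))
    (trans (𝔼-cong N (λ v → cong (_* dif f v) (dif-proj d f v))) (proj-orthogonal d (dif f))))
  (sym (‖proj‖²-split d f)))

pythagoras : ∀ {N} d (f : Fun N) → ‖ f ‖² ≡ ‖ proj d f ‖² + ‖ f ⊖ proj d f ‖²
pythagoras {N} d f = begin
  ‖ f ‖² ≡⟨ solve 2 (λ a p → a := p :+ (a :+ (:- (p :+ p) :+ p))) refl ‖ f ‖² ‖ p ‖² ⟩
  ‖ p ‖² + (‖ f ‖² + (- (‖ p ‖² + ‖ p ‖²) + ‖ p ‖²)) ≡⟨ cong (λ z → ‖ p ‖² + (‖ f ‖² + (- (z + z) + ‖ p ‖²))) (sym (proj-orthogonal d f)) ⟩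
  ‖ p ‖² + (‖ f ‖² + (- (⟨ p , f ⟩ + ⟨ p , f ⟩) + ‖ p ‖²)) ≡⟨ cong (‖ p ‖² +_) (sym expand) ⟩
  ‖ p ‖² + ‖ f ⊖ p ‖² ∎
  where
  open ≡-Reasoning
  p = proj d f
  expand : ‖ f ⊖ p ‖² ≡ ‖ f ‖² + (- (⟨ p , f ⟩ + ⟨ p , f ⟩) + ‖ p ‖²)
  expand = begin
    ‖ f ⊖ p ‖² ≡⟨ 𝔼-cong N (λ v → solve 2 (λ f p → (f :- p) :* (f :- p) := f :* f :+ (con (- (1ℚ + 1ℚ)) :* (p :* f) :+ p :* p)) refl (f v) (p v)) ⟩
    𝔼 N (λ v → f v * f v + (- (1ℚ + 1ℚ) * (p v * f v) + p v * p v)) ≡⟨ 𝔼-+ N _ _ ⟩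
    ‖ f ‖² + 𝔼 N (λ v → - (1ℚ + 1ℚ) * (p v * f v) + p v * p v) ≡⟨ cong (‖ f ‖² +_) (𝔼-+ N _ _) ⟩
    ‖ f ‖² + (𝔼 N (λ v → - (1ℚ + 1ℚ) * (p v * f v)) + ‖ p ‖²) ≡⟨ cong (λ z → ‖ f ‖² + (z + ‖ p ‖²)) (𝔼-* N (- (1ℚ + 1ℚ)) (λ v → p v * f v)) ⟩
    ‖ f ‖² + (- (1ℚ + 1ℚ) * ⟨ p , f ⟩ + ‖ p ‖²) ≡⟨ cong (λ z → ‖ f ‖² + (z + ‖ p ‖²)) (solve 1 (λ x → con (- (1ℚ + 1ℚ)) :* x := :- (x :+ x)) refl ⟨ p , f ⟩) ⟩
    ‖ f ‖² + (- (⟨ p , f ⟩ + ⟨ p , f ⟩) + ‖ p ‖²) ∎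

‖proj‖²≤ : ∀ {N} d (f : Fun N) → ‖ proj d f ‖² ≤ ‖ f ‖²
‖proj‖²≤ d f = ≤-excess _ (0≤‖‖² (f ⊖ proj d f)) (sym (pythagoras d f))

‖⊖proj‖²≤ : ∀ {N} d (f : Fun N) → ‖ f ⊖ proj d f ‖² ≤ ‖ f ‖²
‖⊖proj‖²≤ d f = ≤-excess _ (0≤‖‖² (proj d f)) (trans (+-comm ‖ f ⊖ proj d f ‖² ‖ proj d f ‖²) (sym (pythagoras d f)))

-- Hypercontractivity for low-degree Walsh polynomials

3ℚ 6ℚ 9ℚ : ℚ
3ℚ = ι 3
6ℚ = ι 6
9ℚ = ι 9

sqr : ∀ {N} → Fun N → Fun N
sqr f v = f v ²

-- Averaging the fourth powers of p + q and p - q kills the odd terms and leaves p⁴ + 6p²q² + q⁴.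
-- With K = 9ᵈ, Cauchy-Schwarz and the two induction hypotheses bound the mean of p²q² by
-- 3K‖p‖²‖q‖², because √9 = 3. Then 6 · 3 = 2 · 9 is exactly the cross term of 9K(‖p‖² + ‖q‖²)²;
-- this balance fixes the constant 9.
bonami : ∀ {N} d (f : Fun N) → ‖ sqr (proj d f) ‖² ≤ pow 9ℚ d * ‖ proj d f ‖² ²
bonami {N} zero f = ≤-trans (≤-reflexive (𝔼-zero N (λ v → refl))) (*-nonNeg (nonNegative⁻¹ 1ℚ) (0≤² (‖ proj zero f ‖²)))
bonami {zero} (suc d) f = ≤-trans (≤-reflexive (sym (*-identityˡ _))) (*-monoʳ (0≤² (f [] * f [])) (1≤pow (ι-mono {1} {9} (s≤s z≤n)) (suc d)))
bonami {suc N} (suc d) f = begin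
  ‖ sqr (proj (suc d) f) ‖² ≡⟨ expand ⟩
  ‖ sqr p ‖² + (6ℚ * X + ‖ sqr q ‖²) ≤⟨ lemma {x = X} (pow-nonNeg (0≤ι 9) d) (0≤‖‖² p) (0≤‖‖² q) (0≤‖‖² (sqr q)) (bonami (suc d) (avg f)) (bonami d (dif f)) (cauchy-schwarz (sqr p) (sqr q)) ⟩
  9ℚ * pow 9ℚ d * (‖ p ‖² + ‖ q ‖²) ² ≡⟨ cong (λ z → 9ℚ * pow 9ℚ d * z ²) (sym (‖proj‖²-split d f)) ⟩
  pow 9ℚ (suc d) * ‖ proj (suc d) f ‖² ² ∎
  where
  open ≤-Reasoning
  p = proj (suc d) (avg f)
  q = proj d (dif f)
  X = ⟨ sqr p , sqr q ⟩
  expand : ‖ sqr (proj (suc d) f) ‖² ≡ ‖ sqr p ‖² + (6ℚ * X + ‖ sqr q ‖²)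
  expand = trans (cong (½ *_) (sym (𝔼-+ N _ _))) (trans (sym (𝔼-* N ½ _)) (trans
    (𝔼-cong N (λ v → solve 2 (λ p q →
      con ½ :* ((p :+ con 1ℚ :* q) :* (p :+ con 1ℚ :* q) :* ((p :+ con 1ℚ :* q) :* (p :+ con 1ℚ :* q))
        :+ (p :+ con (- 1ℚ) :* q) :* (p :+ con (- 1ℚ) :* q) :* ((p :+ con (- 1ℚ) :* q) :* (p :+ con (- 1ℚ) :* q)))
      := p :* p :* (p :* p) :+ (con 6ℚ :* (p :* p :* (q :* q)) :+ q :* q :* (q :* q))) refl (p v) (q v)))
    (trans (𝔼-+ N _ _) (cong (‖ sqr p ‖² +_) (trans (𝔼-+ N _ _) (cong (_+ ‖ sqr q ‖²) (𝔼-* N 6ℚ _)))))))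
  lemma : ∀ {K a b s t x} → 0ℚ ≤ K → 0ℚ ≤ a → 0ℚ ≤ b → 0ℚ ≤ t → s ≤ 9ℚ * K * a ² → t ≤ K * b ² → x ² ≤ s * t →
    s + (6ℚ * x + t) ≤ 9ℚ * K * (a + b) ²
  lemma {K} {a} {b} {s} {t} {x} 0≤K 0≤a 0≤b 0≤t s≤ t≤ x²≤ =
    ≤-excess ((9ℚ * K * a ² - s) + 6ℚ * (3ℚ * K * (a * b) - x) + (K * b ² - t) + ι 8 * (K * b ²))
      (+-nonNeg (+-nonNeg (+-nonNeg (≤⇒0≤- s≤) (*-nonNeg (0≤ι 6) (≤⇒0≤- x≤))) (≤⇒0≤- t≤)) (*-nonNeg (0≤ι 8) (*-nonNeg 0≤K (0≤² b))))
      (solve 6 (λ K a b s t x → s :+ (con 6ℚ :* x :+ t) :+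
        ((con 9ℚ :* K :* (a :* a) :- s) :+ con 6ℚ :* (con 3ℚ :* K :* (a :* b) :- x) :+ (K :* (b :* b) :- t) :+ con (ι 8) :* (K :* (b :* b)))
        := con 9ℚ :* K :* ((a :+ b) :* (a :+ b))) refl K a b s t x)
    where
    x≤ : x ≤ 3ℚ * K * (a * b)
    x≤ = ²-cancel-≤ (*-nonNeg (*-nonNeg (0≤ι 3) 0≤K) (*-nonNeg 0≤a 0≤b))
      (≤-trans x²≤ (≤-trans (*-mono (*-nonNeg (*-nonNeg (0≤ι 9) 0≤K) (0≤² a)) 0≤t s≤ t≤)
        (≤-reflexive (solve 3 (λ K a b → con 9ℚ :* K :* (a :* a) :* (K :* (b :* b)) :=
          con 3ℚ :* K :* (a :* b) :* (con 3ℚ :* K :* (a :* b))) refl K a b))))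

-- For a {-1,0,1}-valued g, this is the (2,4)-dual form of hypercontractivity: the low-degree
-- part of g carries only the fraction 3ᵈ ‖g‖ of its mass.
level-inequality : ∀ {N} d (g : Fun N) {τ} → 0ℚ ≤ τ → (∀ v → g v * g v ² ≡ g v) → ‖ g ‖² ≤ τ ² →
  ‖ proj d g ‖² ≤ pow 3ℚ d * τ * ‖ g ‖²
level-inequality {N} d g {τ} 0≤τ g³≡g g≤ = cancel A≤ 0≤c (²-cancel-≤ (*-nonNeg A≤ 0≤c) A⁴≤)
  where
  q = proj d g
  A = ‖ q ‖²
  p = ‖ g ‖²
  A≤ : 0ℚ ≤ A
  A≤ = 0≤‖‖² q
  0≤p : 0ℚ ≤ p
  0≤p = 0≤‖‖² g
  T = pow 3ℚ d
  0≤T : 0ℚ ≤ T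
  0≤T = pow-nonNeg (0≤ι 3) d
  c = T * τ * p
  0≤c : 0ℚ ≤ c
  0≤c = *-nonNeg (*-nonNeg 0≤T 0≤τ) 0≤p
  qg : Fun N
  qg v = q v * g v
  B = ‖ qg ‖²
  ‖g²‖ : ‖ sqr g ‖² ≡ p
  ‖g²‖ = 𝔼-cong N (λ v → trans (*-assoc (g v) (g v) (g v ²)) (cong (g v *_) (g³≡g v)))
  -- Hölder's inequality with exponents 4 and 4/3, done by two uses of Cauchy-Schwarz: writing g as
  -- g · g² gives A² ≤ B p, and then B² is at most the fourth moment of q times p.
  A≡ : A ≡ ⟨ qg , sqr g ⟩
  A≡ = trans (sym (proj-orthogonal d g)) (𝔼-cong N (λ v → trans (cong (q v *_) (sym (g³≡g v))) (sym (*-assoc (q v) (g v) (g v ²)))))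
  A²≤ : A ² ≤ B * p
  A²≤ = subst (λ z → z ² ≤ B * p) (sym A≡) (subst (λ z → ⟨ qg , sqr g ⟩ ² ≤ B * z) ‖g²‖ (cauchy-schwarz qg (sqr g)))
  B≡ : B ≡ ⟨ sqr q , sqr g ⟩
  B≡ = 𝔼-cong N (λ v → solve 2 (λ x y → x :* y :* (x :* y) := x :* x :* (y :* y)) refl (q v) (g v))
  B²≤ : B ² ≤ ‖ sqr q ‖² * p
  B²≤ = subst (λ z → z ² ≤ ‖ sqr q ‖² * p) (sym B≡) (subst (λ z → ⟨ sqr q , sqr g ⟩ ² ≤ ‖ sqr q ‖² * z) ‖g²‖ (cauchy-schwarz (sqr q) (sqr g)))
  9≡ : pow 9ℚ d ≡ T ²
  9≡ = pow-* 3ℚ 3ℚ d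
  A⁴≤ : (A ²) ² ≤ (A * c) ²
  A⁴≤ = begin
    (A ²) ² ≤⟨ *-mono (*-nonNeg (0≤‖‖² qg) 0≤p) (0≤² A) A²≤ A²≤ ⟩
    (B * p) ² ≡⟨ solve 2 (λ b p → b :* p :* (b :* p) := b :* b :* (p :* p)) refl B p ⟩
    B ² * p ² ≤⟨ *-monoʳ (0≤² p) B²≤ ⟩
    ‖ sqr q ‖² * p * p ² ≤⟨ *-monoʳ (0≤² p) (*-monoʳ 0≤p (bonami d g)) ⟩
    pow 9ℚ d * A ² * p * p ² ≡⟨ cong (λ z → z * A ² * p * p ²) 9≡ ⟩
    T ² * A ² * p * p ² ≤⟨ *-monoʳ (0≤² p) (*-monoˡ (*-nonNeg (0≤² T) (0≤² A)) g≤) ⟩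
    T ² * A ² * τ ² * p ² ≡⟨ solve 4 (λ T A t p → T :* T :* (A :* A) :* (t :* t) :* (p :* p) := A :* (T :* t :* p) :* (A :* (T :* t :* p))) refl T A τ p ⟩
    (A * c) ² ∎
    where open ≤-Reasoning
  cancel : ∀ {a b} → 0ℚ ≤ a → 0ℚ ≤ b → a ² ≤ a * b → a ≤ b
  cancel {a} {b} 0≤a 0≤b le with a ≤? b
  ... | yes a≤b = a≤b
  ... | no a≰b = *-cancelˡ-≤-pos a {{positive (≤-<-trans 0≤b (≰⇒> a≰b))}} le

-- Discrete derivatives and total influence

D : ∀ {N} → Fin N → Fun N → Fun N
D j f v = ½ * (f v - f (v [ j ]%= not))

-- `D j` keeps exactly the Walsh characters containing j, with unchanged coefficients, so this is
-- the sum of the squared coefficients weighted by degree.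
influence : ∀ {N} → Fun N → ℚ
influence {N} f = sumFin N (λ j → ‖ D j f ‖²)

0≤influence : ∀ {N} (f : Fun N) → 0ℚ ≤ influence f
0≤influence {N} f = sumFin-nonNeg N (λ j → 0≤‖‖² (D j f))

avg-D-zero : ∀ {N} (f : Fun (suc N)) v → avg (D F.zero f) v ≡ 0ℚ
avg-D-zero f v = solve 2 (λ a b → con ½ :* (con ½ :* (a :- b) :+ con ½ :* (b :- a)) := con 0ℚ) refl (f (false ∷ v)) (f (true ∷ v))

dif-D-zero : ∀ {N} (f : Fun (suc N)) v → dif (D F.zero f) v ≡ dif f v
dif-D-zero f v = solve 2 (λ a b → con ½ :* (con ½ :* (a :- b) :- con ½ :* (b :- a)) := con ½ :* (a :- b)) refl (f (false ∷ v)) (f (true ∷ v))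

avg-D-suc : ∀ {N} j (f : Fun (suc N)) v → avg (D (F.suc j) f) v ≡ D j (avg f) v
avg-D-suc j f v = solve 4 (λ a b x y → con ½ :* (con ½ :* (a :- x) :+ con ½ :* (b :- y)) := con ½ :* (con ½ :* (a :+ b) :- con ½ :* (x :+ y))) refl
  (f (false ∷ v)) (f (true ∷ v)) (f (false ∷ (v [ j ]%= not))) (f (true ∷ (v [ j ]%= not)))

dif-D-suc : ∀ {N} j (f : Fun (suc N)) v → dif (D (F.suc j) f) v ≡ D j (dif f) v
dif-D-suc j f v = solve 4 (λ a b x y → con ½ :* (con ½ :* (a :- x) :- con ½ :* (b :- y)) := con ½ :* (con ½ :* (a :- b) :- con ½ :* (x :- y))) refl
  (f (false ∷ v)) (f (true ∷ v)) (f (false ∷ (v [ j ]%= not))) (f (true ∷ (v [ j ]%= not)))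

‖D-zero‖² : ∀ {N} (f : Fun (suc N)) → ‖ D F.zero f ‖² ≡ ‖ dif f ‖²
‖D-zero‖² {N} f = trans (‖‖²-split (D F.zero f) (λ _ → 0ℚ) (dif f) (avg-D-zero f) (dif-D-zero f))
  (trans (cong (_+ ‖ dif f ‖²) (𝔼-zero N (λ _ → refl))) (+-identityˡ ‖ dif f ‖²))

influence-split : ∀ {N} (f : Fun (suc N)) → influence f ≡ ‖ dif f ‖² + (influence (avg f) + influence (dif f))
influence-split {N} f = cong₂ _+_ (‖D-zero‖² f)
  (trans (sumFin-cong N (λ j → ‖‖²-split (D (F.suc j) f) (D j (avg f)) (D j (dif f)) (avg-D-suc j f) (dif-D-suc j f))) (sumFin-+ N _ _))

-- The residual consists of the sets of size at least d, each of which the influence counts at least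
-- d times. In the induction a set containing the first bit is counted once for that bit and, within
-- `dif f`, d more times.
high-degree≤influence : ∀ {N} d (f : Fun N) → ι d * ‖ f ⊖ proj d f ‖² ≤ influence f
high-degree≤influence zero f = ≤-trans (≤-reflexive (*-zeroˡ ‖ f ⊖ proj 0 f ‖²)) (0≤influence f)
high-degree≤influence {zero} (suc d) f = ≤-reflexive (trans (cong (λ z → ι (suc d) * z ²) (+-inverseʳ (f []))) (*-zeroʳ (ι (suc d))))
high-degree≤influence {suc N} (suc d) f = begin
  ι (suc d) * ‖ f ⊖ proj (suc d) f ‖² ≡⟨ cong (ι (suc d) *_) (‖⊖proj‖²-split d f) ⟩
  ι (suc d) * (S₁ + S₂) ≡⟨ *-distribˡ-+ (ι (suc d)) S₁ S₂ ⟩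
  ι (suc d) * S₁ + ι (suc d) * S₂ ≡⟨ cong (λ z → ι (suc d) * S₁ + z * S₂) (ι-suc d) ⟩
  ι (suc d) * S₁ + (1ℚ + ι d) * S₂ ≡⟨ solve 3 (λ x d s → x :+ (con 1ℚ :+ d) :* s := s :+ (x :+ d :* s)) refl (ι (suc d) * S₁) (ι d) S₂ ⟩
  S₂ + (ι (suc d) * S₁ + ι d * S₂) ≤⟨ +-mono-≤ (‖⊖proj‖²≤ d (dif f)) (+-mono-≤ (high-degree≤influence (suc d) (avg f)) (high-degree≤influence d (dif f))) ⟩
  ‖ dif f ‖² + (influence (avg f) + influence (dif f)) ≡⟨ sym (influence-split f) ⟩
  influence f ∎
  where
  open ≤-Reasoning
  S₁ = ‖ avg f ⊖ proj (suc d) (avg f) ‖²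
  S₂ = ‖ dif f ⊖ proj d (dif f) ‖²

-- Conditional expectation given the bits marked true in J.
cond : ∀ {N} → Vec Bool N → Fun N → Fun N
cond [] f [] = f []
cond (true ∷ J) f (x ∷ v) = cond J (λ w → f (x ∷ w)) v
cond (false ∷ J) f (x ∷ v) = cond J (avg f) v

cond-cong : ∀ {N} J {f g : Fun N} → (∀ v → f v ≡ g v) → ∀ v → cond J f v ≡ cond J g v
cond-cong [] eq [] = eq []
cond-cong (true ∷ J) eq (x ∷ v) = cond-cong J (λ w → eq (x ∷ w)) v
cond-cong (false ∷ J) eq (x ∷ v) = cond-cong J (avg-cong eq) v

cond-+ : ∀ {N} J (f g : Fun N) v → cond J (λ w → f w + g w) v ≡ cond J f v + cond J g v
cond-+ [] f g [] = refl
cond-+ (true ∷ J) f g (x ∷ v) = cond-+ J (λ w → f (x ∷ w)) (λ w → g (x ∷ w)) v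
cond-+ (false ∷ J) f g (x ∷ v) = trans (cond-cong J
  (λ w → solve 4 (λ a b x y → con ½ :* (a :+ x :+ (b :+ y)) := con ½ :* (a :+ b) :+ con ½ :* (x :+ y)) refl (f (false ∷ w)) (f (true ∷ w)) (g (false ∷ w)) (g (true ∷ w))) v)
  (cond-+ J (avg f) (avg g) v)

cond-* : ∀ {N} J c (f : Fun N) v → cond J (λ w → c * f w) v ≡ c * cond J f v
cond-* [] c f [] = refl
cond-* (true ∷ J) c f (x ∷ v) = cond-* J c (λ w → f (x ∷ w)) v
cond-* (false ∷ J) c f (x ∷ v) = trans (cond-cong J
  (λ w → solve 3 (λ c a b → con ½ :* (c :* a :+ c :* b) := c :* (con ½ :* (a :+ b))) refl c (f (false ∷ w)) (f (true ∷ w))) v)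
  (cond-* J c (avg f) v)

avg-cond : ∀ {N} J (f : Fun (suc N)) v → avg (cond (true ∷ J) f) v ≡ cond J (avg f) v
avg-cond J f v = sym (trans (cond-* J ½ _ v) (cong (½ *_) (cond-+ J (λ w → f (false ∷ w)) (λ w → f (true ∷ w)) v)))

dif-cond : ∀ {N} J (f : Fun (suc N)) v → dif (cond (true ∷ J) f) v ≡ cond J (dif f) v
dif-cond J f v = sym (begin
  cond J (λ w → ½ * (f₀ w - f₁ w)) v ≡⟨ cond-* J ½ (λ w → f₀ w - f₁ w) v ⟩
  ½ * cond J (λ w → f₀ w - f₁ w) v ≡⟨ cong (½ *_) (cond-cong J (λ w → cong (f₀ w +_) (neg w)) v) ⟩
  ½ * cond J (λ w → f₀ w + - 1ℚ * f₁ w) v ≡⟨ cong (½ *_) (cond-+ J f₀ (λ w → - 1ℚ * f₁ w) v) ⟩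
  ½ * (cond J f₀ v + cond J (λ w → - 1ℚ * f₁ w) v) ≡⟨ cong (λ z → ½ * (cond J f₀ v + z)) (cond-* J (- 1ℚ) f₁ v) ⟩
  ½ * (cond J f₀ v + - 1ℚ * cond J f₁ v) ≡⟨ solve 2 (λ a b → con ½ :* (a :+ con (- 1ℚ) :* b) := con ½ :* (a :- b)) refl (cond J f₀ v) (cond J f₁ v) ⟩
  ½ * (cond J f₀ v - cond J f₁ v) ∎)
  where
  open ≡-Reasoning
  f₀ = λ w → f (false ∷ w)
  f₁ = λ w → f (true ∷ w)
  neg : ∀ w → - f₁ w ≡ - 1ℚ * f₁ w
  neg w = solve 1 (λ a → :- a := con (- 1ℚ) :* a) refl (f₁ w)

‖⊖cond‖²-true : ∀ {N} J (f : Fun (suc N)) → ‖ f ⊖ cond (true ∷ J) f ‖² ≡ ‖ avg f ⊖ cond J (avg f) ‖² + ‖ dif f ⊖ cond J (dif f) ‖²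
‖⊖cond‖²-true J f = ‖‖²-split (f ⊖ cond (true ∷ J) f) (avg f ⊖ cond J (avg f)) (dif f ⊖ cond J (dif f))
  (λ v → trans (avg-⊖ f (cond (true ∷ J) f) v) (cong (λ z → avg f v - z) (avg-cond J f v)))
  (λ v → trans (dif-⊖ f (cond (true ∷ J) f) v) (cong (λ z → dif f v - z) (dif-cond J f v)))

‖⊖cond‖²-false : ∀ {N} J (f : Fun (suc N)) → ‖ f ⊖ cond (false ∷ J) f ‖² ≡ ‖ avg f ⊖ cond J (avg f) ‖² + ‖ dif f ‖²
‖⊖cond‖²-false J f = ‖‖²-split (f ⊖ cond (false ∷ J) f) (avg f ⊖ cond J (avg f)) (dif f)
  (λ v → solve 3 (λ a b c → con ½ :* ((a :- c) :+ (b :- c)) := con ½ :* (a :+ b) :- c) refl (f (false ∷ v)) (f (true ∷ v)) (cond J (avg f) v))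
  (λ v → solve 3 (λ a b c → con ½ :* ((a :- c) :- (b :- c)) := con ½ :* (a :- b)) refl (f (false ∷ v)) (f (true ∷ v)) (cond J (avg f) v))

‖⊖cond‖²≤ : ∀ {N} J (f : Fun N) → ‖ f ⊖ cond J f ‖² ≤ ‖ f ‖²
‖⊖cond‖²≤ [] f = ≤-trans (≤-reflexive (cong _² (+-inverseʳ (f [])))) (0≤² (f []))
‖⊖cond‖²≤ (true ∷ J) f = ≤-trans (≤-reflexive (‖⊖cond‖²-true J f))
  (≤-trans (+-mono-≤ (‖⊖cond‖²≤ J (avg f)) (‖⊖cond‖²≤ J (dif f))) (≤-reflexive (sym (⟨⟩-split f f))))
‖⊖cond‖²≤ (false ∷ J) f = ≤-trans (≤-reflexive (‖⊖cond‖²-false J f))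
  (≤-trans (+-monoˡ-≤ ‖ dif f ‖² (‖⊖cond‖²≤ J (avg f))) (≤-reflexive (sym (⟨⟩-split f f))))

outside : Bool → ℚ
outside true = 0ℚ
outside false = 1ℚ

0≤outside : ∀ b → 0ℚ ≤ outside b
0≤outside true = ≤-refl
0≤outside false = nonNegative⁻¹ 1ℚ

lowInfluence : ∀ {N} → Vec Bool N → ℕ → Fun N → ℚ
lowInfluence {N} J d f = sumFin N (λ j → outside (lookup J j) * ‖ proj d (D j f) ‖²)

0≤lowInfluence : ∀ {N} (J : Vec Bool N) d (f : Fun N) → 0ℚ ≤ lowInfluence J d f
0≤lowInfluence {N} J d f = sumFin-nonNeg N (λ j → *-nonNeg (0≤outside (lookup J j)) (0≤‖‖² (proj d (D j f))))

lowInfluence-suc : ∀ {N} (J : Vec Bool N) d (f : Fun (suc N)) →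
  sumFin N (λ j → outside (lookup J j) * ‖ proj (suc d) (D (F.suc j) f) ‖²) ≡ lowInfluence J (suc d) (avg f) + lowInfluence J d (dif f)
lowInfluence-suc {N} J d f = trans (sumFin-cong N (λ j → trans (cong (outside (lookup J j) *_) (split j))
  (*-distribˡ-+ (outside (lookup J j)) ‖ proj (suc d) (D j (avg f)) ‖² ‖ proj d (D j (dif f)) ‖²))) (sumFin-+ N _ _)
  where
  split : ∀ j → ‖ proj (suc d) (D (F.suc j) f) ‖² ≡ ‖ proj (suc d) (D j (avg f)) ‖² + ‖ proj d (D j (dif f)) ‖²
  split j = trans (‖proj‖²-split d (D (F.suc j) f))
    (cong₂ _+_ (‖‖²-cong (proj-cong (suc d) (avg-D-suc j f))) (‖‖²-cong (proj-cong d (dif-D-suc j f))))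

-- The residual `f ⊖ cond J f` lives on the Walsh sets not contained in J. Such a set either has
-- size at least d, or has size less than d and contains some j outside J, and is then counted by
-- the low-degree part of `D j f`.
‖⊖cond‖²≤low+high : ∀ {N} (J : Vec Bool N) d (f : Fun N) →
  ‖ f ⊖ cond J f ‖² ≤ lowInfluence J d f + ‖ f ⊖ proj d f ‖²
‖⊖cond‖²≤low+high {N} J zero f = ≤-trans (‖⊖cond‖²≤ J f) (≤-excess (lowInfluence J 0 f) (0≤lowInfluence J 0 f)
  (trans (+-comm ‖ f ‖² (lowInfluence J 0 f)) (cong (lowInfluence J 0 f +_) (‖‖²-cong (λ v → solve 1 (λ x → x := x :- con 0ℚ) refl (f v))))))
‖⊖cond‖²≤low+high [] (suc d) f = ≤-trans (≤-reflexive (cong _² (+-inverseʳ (f [])))) (+-nonNeg ≤-refl (0≤² (f [] - f [])))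
‖⊖cond‖²≤low+high {suc N} (true ∷ J) (suc d) f = begin
  ‖ f ⊖ cond (true ∷ J) f ‖² ≡⟨ ‖⊖cond‖²-true J f ⟩
  ‖ avg f ⊖ cond J (avg f) ‖² + ‖ dif f ⊖ cond J (dif f) ‖² ≤⟨ +-mono-≤ (‖⊖cond‖²≤low+high J (suc d) (avg f)) (‖⊖cond‖²≤low+high J d (dif f)) ⟩
  (La + Ha) + (Lb + Hb) ≡⟨ solve 5 (λ a b c d z → (a :+ b) :+ (c :+ d) := (con 0ℚ :* z :+ (a :+ c)) :+ (b :+ d)) refl La Ha Lb Hb ‖ proj (suc d) (D F.zero f) ‖² ⟩
  (0ℚ * ‖ proj (suc d) (D F.zero f) ‖² + (La + Lb)) + (Ha + Hb) ≡⟨ cong₂ (λ x y → (0ℚ * ‖ proj (suc d) (D F.zero f) ‖² + x) + y) (sym (lowInfluence-suc J d f)) (sym (‖⊖proj‖²-split d f)) ⟩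
  lowInfluence (true ∷ J) (suc d) f + ‖ f ⊖ proj (suc d) f ‖² ∎
  where
  open ≤-Reasoning
  La = lowInfluence J (suc d) (avg f)
  Lb = lowInfluence J d (dif f)
  Ha = ‖ avg f ⊖ proj (suc d) (avg f) ‖²
  Hb = ‖ dif f ⊖ proj d (dif f) ‖²
‖⊖cond‖²≤low+high {suc N} (false ∷ J) (suc d) f = begin
  ‖ f ⊖ cond (false ∷ J) f ‖² ≡⟨ ‖⊖cond‖²-false J f ⟩
  ‖ avg f ⊖ cond J (avg f) ‖² + ‖ dif f ‖² ≤⟨ +-monoˡ-≤ ‖ dif f ‖² (‖⊖cond‖²≤low+high J (suc d) (avg f)) ⟩
  (La + Ha) + ‖ dif f ‖² ≡⟨ cong (La + Ha +_) (pythagoras d (dif f)) ⟩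
  -- `Lb` is pure slack: the small sets containing the first bit are already charged to that bit
  -- through `Pb`.
  (La + Ha) + (Pb + Hb) ≤⟨ ≤-excess Lb (0≤lowInfluence J d (dif f)) (solve 5 (λ a b c d l → ((a :+ b) :+ (c :+ d)) :+ l := (c :+ (a :+ l)) :+ (b :+ d)) refl La Ha Pb Hb Lb) ⟩
  (Pb + (La + Lb)) + (Ha + Hb) ≤⟨ +-monoˡ-≤ (Ha + Hb) (+-monoˡ-≤ (La + Lb) Pb≤) ⟩
  (1ℚ * ‖ proj (suc d) (D F.zero f) ‖² + (La + Lb)) + (Ha + Hb) ≡⟨ cong₂ (λ x y → (1ℚ * ‖ proj (suc d) (D F.zero f) ‖² + x) + y) (sym (lowInfluence-suc J d f)) (sym (‖⊖proj‖²-split d f)) ⟩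
  lowInfluence (false ∷ J) (suc d) f + ‖ f ⊖ proj (suc d) f ‖² ∎
  where
  open ≤-Reasoning
  La = lowInfluence J (suc d) (avg f)
  Lb = lowInfluence J d (dif f)
  Ha = ‖ avg f ⊖ proj (suc d) (avg f) ‖²
  Hb = ‖ dif f ⊖ proj d (dif f) ‖²
  Pb = ‖ proj d (dif f) ‖²
  Pb≤ : Pb ≤ 1ℚ * ‖ proj (suc d) (D F.zero f) ‖²
  Pb≤ = ≤-excess ‖ proj (suc d) (avg (D F.zero f)) ‖² (0≤‖‖² (proj (suc d) (avg (D F.zero f))))
    (trans (+-comm Pb _) (trans (cong (‖ proj (suc d) (avg (D F.zero f)) ‖² +_) (sym (‖‖²-cong (proj-cong d (dif-D-zero f)))))
      (trans (sym (‖proj‖²-split d (D F.zero f))) (sym (*-identityˡ ‖ proj (suc d) (D F.zero f) ‖²)))))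

-- The cut at degree 1, with the low part bounded crudely. The resulting factor 2 gives the bound
-- the shape of `friedgut` at d = 1, but for arbitrary J.
poincaré : ∀ {N} (J : Vec Bool N) (f : Fun N) → ‖ f ⊖ cond J f ‖² ≤ influence f + influence f
poincaré {N} J f = ≤-trans (‖⊖cond‖²≤low+high J 1 f) (+-mono-≤ (sumFin-mono N low) (≤-trans (≤-reflexive (sym (*-identityˡ _))) (high-degree≤influence 1 f)))
  where
  low : ∀ j → outside (lookup J j) * ‖ proj 1 (D j f) ‖² ≤ ‖ D j f ‖²
  low j with lookup J j
  ... | true = ≤-trans (≤-reflexive (*-zeroˡ ‖ proj 1 (D j f) ‖²)) (0≤‖‖² (D j f))
  ... | false = ≤-trans (≤-reflexive (*-identityˡ ‖ proj 1 (D j f) ‖²)) (‖proj‖²≤ 1 (D j f))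

-- The condition on τ makes the low-degree error outside J at most influence / d, which is also the
-- size of the high-degree error.
friedgut : ∀ {N} (J : Vec Bool N) d {τ} (f : Fun N) → 0ℚ ≤ τ → ι d * (pow 3ℚ d * τ) ≤ 1ℚ →
  (∀ j v → D j f v * D j f v ² ≡ D j f v) → (∀ j → lookup J j ≡ false → ‖ D j f ‖² ≤ τ ²) →
  ι d * ‖ f ⊖ cond J f ‖² ≤ influence f + influence f
friedgut {N} J d {τ} f 0≤τ dτ≤1 D³≡D small = begin
  ι d * ‖ f ⊖ cond J f ‖² ≤⟨ *-monoˡ (0≤ι d) (‖⊖cond‖²≤low+high J d f) ⟩
  ι d * (lowInfluence J d f + H) ≤⟨ *-monoˡ (0≤ι d) (+-monoˡ-≤ H (≤-trans (sumFin-mono N low) (≤-reflexive (sumFin-* N c (λ j → ‖ D j f ‖²))))) ⟩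
  ι d * (c * influence f + H) ≡⟨ solve 4 (λ d c i h → d :* (c :* i :+ h) := d :* c :* i :+ d :* h) refl (ι d) c (influence f) H ⟩
  ι d * c * influence f + ι d * H ≤⟨ +-mono-≤ (*-monoʳ (0≤influence f) dτ≤1) (high-degree≤influence d f) ⟩
  1ℚ * influence f + influence f ≡⟨ cong (_+ influence f) (*-identityˡ (influence f)) ⟩
  influence f + influence f ∎
  where
  open ≤-Reasoning
  H = ‖ f ⊖ proj d f ‖²
  c = pow 3ℚ d * τ
  0≤c : 0ℚ ≤ c
  0≤c = *-nonNeg (pow-nonNeg (0≤ι 3) d) 0≤τ
  low : ∀ j → outside (lookup J j) * ‖ proj d (D j f) ‖² ≤ c * ‖ D j f ‖²
  low j with lookup J j in eq
  ... | true = ≤-trans (≤-reflexive (*-zeroˡ ‖ proj d (D j f) ‖²)) (*-nonNeg 0≤c (0≤‖‖² (D j f)))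
  ... | false = ≤-trans (≤-reflexive (*-identityˡ ‖ proj d (D j f) ‖²)) (level-inequality d (D j f) 0≤τ (D³≡D j) (small j eq))

-- Encoding of one coordinate by bits

num : ∀ {s} → Vec Bool s → ℕ
num [] = 0
num {suc s} (b ∷ u) = (if b then 2 ℕ.^ s else 0) ℕ.+ num u

num< : ∀ {s} (u : Vec Bool s) → num u ℕ.≤ 2 ℕ.^ s
num< [] = z≤n
num< {suc s} (false ∷ u) = ℕₚ.≤-trans (num< u) (ℕₚ.m≤m+n _ _)
num< {suc s} (true ∷ u) = ℕₚ.+-monoʳ-≤ (2 ℕ.^ s) (ℕₚ.≤-trans (num< u) (ℕₚ.m≤m+n _ 0))

tvℕ : (ℕ → ℚ) → ℕ → ℕ → ℚ
tvℕ κ o zero = 0ℚ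
tvℕ κ o (suc L) = ∣ κ (suc o) - κ o ∣ + tvℕ κ (suc o) L

0≤tvℕ : ∀ κ o L → 0ℚ ≤ tvℕ κ o L
0≤tvℕ κ o zero = ≤-refl
0≤tvℕ κ o (suc L) = +-nonNeg (0≤∣p∣ (κ (suc o) - κ o)) (0≤tvℕ κ (suc o) L)

tvℕ-+ : ∀ κ o a b → tvℕ κ o (a ℕ.+ b) ≡ tvℕ κ o a + tvℕ κ (a ℕ.+ o) b
tvℕ-+ κ o zero b = sym (+-identityˡ (tvℕ κ o b))
tvℕ-+ κ o (suc a) b = trans (cong (∣ κ (suc o) - κ o ∣ +_) (trans (tvℕ-+ κ (suc o) a b)
  (cong (λ z → tvℕ κ (suc o) a + tvℕ κ z b) (ℕₚ.+-suc a o)))) (sym (+-assoc ∣ κ (suc o) - κ o ∣ _ _))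

∣κ-κ∣≤tvℕ : ∀ κ o L → ∣ κ (L ℕ.+ o) - κ o ∣ ≤ tvℕ κ o L
∣κ-κ∣≤tvℕ κ o zero = ≤-reflexive (∣a-a∣≡0 (κ o))
∣κ-κ∣≤tvℕ κ o (suc L) = ≤-trans (∣a-c∣≤ (κ (suc L ℕ.+ o)) (κ (suc o)) (κ o))
  (≤-trans (≤-reflexive (+-comm ∣ κ (suc L ℕ.+ o) - κ (suc o) ∣ ∣ κ (suc o) - κ o ∣))
    (+-monoʳ-≤ ∣ κ (suc o) - κ o ∣ (subst (λ z → ∣ κ z - κ (suc o) ∣ ≤ tvℕ κ (suc o) L) (ℕₚ.+-suc L o) (∣κ-κ∣≤tvℕ κ (suc o) L))))

tvℕ-window : ∀ κ o a L r → tvℕ κ (a ℕ.+ o) L ≤ tvℕ κ o (a ℕ.+ (L ℕ.+ r))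
tvℕ-window κ o a L r = ≤-trans (≤-excess _ (0≤tvℕ κ (L ℕ.+ (a ℕ.+ o)) r) (sym (tvℕ-+ κ (a ℕ.+ o) L r)))
  (≤-excess _ (0≤tvℕ κ o a) (trans (+-comm _ (tvℕ κ o a)) (sym (tvℕ-+ κ o a (L ℕ.+ r)))))

∣D∣-cong : ∀ {N} (j : Fin N) {f g : Fun N} → (∀ v → f v ≡ g v) → 𝔼 N (λ v → ∣ D j f v ∣) ≡ 𝔼 N (λ v → ∣ D j g v ∣)
∣D∣-cong {N} j eq = 𝔼-cong N (λ v → cong₂ (λ a b → ∣ ½ * (a - b) ∣) (eq v) (eq (v [ j ]%= not)))

-- Each half of the dyadic interval contributes at most its own variation, with weight ½, and
-- exchanging the halves costs at most half of the total variation.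
bit-variation≤tvℕ : ∀ s κ o → sumFin s (λ r → 𝔼 s (λ u → ∣ D r (λ u′ → κ (num u′ ℕ.+ o)) u ∣)) ≤ tvℕ κ o (2 ℕ.^ s)
bit-variation≤tvℕ zero κ o = 0≤tvℕ κ o 1
bit-variation≤tvℕ (suc s) κ o = begin
  sumFin (suc s) (λ r → 𝔼 (suc s) (λ u → ∣ D r (λ u′ → κ (num u′ ℕ.+ o)) u ∣)) ≤⟨ +-mono-≤ head≤ tail≤ ⟩
  ½ * tvℕ κ o (2 ℕ.^ suc s) + ½ * tvℕ κ o (2 ℕ.^ suc s) ≡⟨ solve 1 (λ x → con ½ :* x :+ con ½ :* x := x) refl (tvℕ κ o (2 ℕ.^ suc s)) ⟩
  tvℕ κ o (2 ℕ.^ suc s) ∎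
  where
  open ≤-Reasoning
  M = 2 ℕ.^ s
  T = tvℕ κ o (2 ℕ.^ suc s)
  K : Bool → Fun s
  K b u = κ (num (b ∷ u) ℕ.+ o)
  -- The two points are `M` apart, and `num u` is at most `M`, so the window between them stays
  -- inside the interval of `T`. That interval has 2 ^ suc s steps, one beyond the last number; this
  -- makes lengths of halves add up, and the extra step is covered by the later bound for arbitrary
  -- lengths.
  cross : ∀ u → ∣ K true u - K false u ∣ ≤ T
  cross u = begin
    ∣ κ (M ℕ.+ num u ℕ.+ o) - κ (num u ℕ.+ o) ∣ ≡⟨ cong (λ z → ∣ κ z - κ (num u ℕ.+ o) ∣) (ℕₚ.+-assoc M (num u) o) ⟩
    ∣ κ (M ℕ.+ (num u ℕ.+ o)) - κ (num u ℕ.+ o) ∣ ≤⟨ ∣κ-κ∣≤tvℕ κ (num u ℕ.+ o) M ⟩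
    tvℕ κ (num u ℕ.+ o) M ≤⟨ tvℕ-window κ o (num u) M (M ℕ.∸ num u) ⟩
    tvℕ κ o (num u ℕ.+ (M ℕ.+ (M ℕ.∸ num u))) ≡⟨ cong (tvℕ κ o) lengths ⟩
    T ∎
    where
    lengths : num u ℕ.+ (M ℕ.+ (M ℕ.∸ num u)) ≡ M ℕ.+ (M ℕ.+ 0)
    lengths = trans (sym (ℕₚ.+-assoc (num u) M _)) (trans (cong (ℕ._+ (M ℕ.∸ num u)) (ℕₚ.+-comm (num u) M))
      (trans (ℕₚ.+-assoc M (num u) _) (cong (M ℕ.+_) (trans (ℕₚ.m+[n∸m]≡n (num< u)) (sym (ℕₚ.+-identityʳ M))))))
  half : ∀ {x} → ∣ x ∣ ≤ T → ∣ ½ * x ∣ ≤ ½ * T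
  half {x} x≤ = ≤-trans (≤-reflexive (∣p*q∣≡∣p∣*∣q∣ ½ x)) (*-monoˡ 0≤½ x≤)
  E≤ : ∀ {f : Fun s} {c} → (∀ u → f u ≤ c) → 𝔼 s f ≤ c
  E≤ {c = c} f≤ = ≤-trans (𝔼-mono s f≤) (≤-reflexive (𝔼-const s c))
  head≤ : 𝔼 (suc s) (λ u → ∣ D F.zero (λ u′ → κ (num u′ ℕ.+ o)) u ∣) ≤ ½ * T
  head≤ = ≤-trans (*-monoˡ 0≤½ (+-mono-≤
      (E≤ (λ u → half {K false u - K true u} (subst (_≤ T) (∣a-b∣≡∣b-a∣ (K true u) (K false u)) (cross u))))
      (E≤ (λ u → half {K true u - K false u} (cross u)))))
    (≤-reflexive (solve 1 (λ x → con ½ :* (con ½ :* x :+ con ½ :* x) := con ½ :* x) refl T))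
  A : Bool → Fin s → ℚ
  A b r = 𝔼 s (λ u → ∣ D r (K b) u ∣)
  upper : sumFin s (A true) ≤ tvℕ κ (M ℕ.+ o) M
  upper = ≤-trans (≤-reflexive (sumFin-cong s (λ r → ∣D∣-cong r (λ u → cong κ (trans (cong (ℕ._+ o) (ℕₚ.+-comm M (num u))) (ℕₚ.+-assoc (num u) M o))))))
    (bit-variation≤tvℕ s κ (M ℕ.+ o))
  tail≤ : sumFin s (λ r → ½ * (A false r + A true r)) ≤ ½ * T
  tail≤ = begin
    sumFin s (λ r → ½ * (A false r + A true r)) ≡⟨ sumFin-* s ½ (λ r → A false r + A true r) ⟩
    ½ * sumFin s (λ r → A false r + A true r) ≡⟨ cong (½ *_) (sumFin-+ s (A false) (A true)) ⟩
    ½ * (sumFin s (A false) + sumFin s (A true)) ≤⟨ *-monoˡ 0≤½ (+-mono-≤ (bit-variation≤tvℕ s κ o) upper) ⟩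
    ½ * (tvℕ κ o M + tvℕ κ (M ℕ.+ o) M) ≡⟨ cong (½ *_) (trans (sym (tvℕ-+ κ o M M)) (cong (λ z → tvℕ κ o (M ℕ.+ z)) (sym (ℕₚ.+-identityʳ M)))) ⟩
    ½ * T ∎

-- min (⌊ z / q ⌋, k) as an element of Fin (suc k).
step : ∀ (q k z : ℕ) → Fin (suc k)
step q zero z = F.zero
step q (suc k) z with z ℕ.<? q
... | yes _ = F.zero
... | no _ = F.suc (step q k (z ℕ.∸ q))

step-start : ∀ q .{{_ : NonZero q}} k → step q k 0 ≡ F.zero
step-start q zero = refl
step-start q@(suc _) (suc k) with 0 ℕ.<? q
... | yes _ = refl
... | no 0≮q = ⊥-elim (0≮q (s≤s z≤n))

step-shift : ∀ q k z → step q (suc k) (q ℕ.+ z) ≡ F.suc (step q k z)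
step-shift q k z with q ℕ.+ z ℕ.<? q
... | yes q+z<q = ⊥-elim (ℕₚ.m+n≮m q z q+z<q)
... | no _ = cong (λ w → F.suc (step q k w)) (ℕₚ.m+n∸m≡n q z)

step-first : ∀ q k z → z ℕ.< q → step q k z ≡ F.zero
step-first q zero z z<q = refl
step-first q (suc k) z z<q with z ℕ.<? q
... | yes _ = refl
... | no z≮q = ⊥-elim (z≮q z<q)

-- The pair function ρ is left abstract so that sums over components or over thresholds can be taken
-- along a whole path at once.
edges : ∀ k → (Fin (suc k) → Fin (suc k) → ℚ) → ℚ
edges zero ρ = 0ℚ
edges (suc k) ρ = ρ (F.suc F.zero) F.zero + edges k (λ a b → ρ (F.suc a) (F.suc b))

edgesFrom : ∀ k → (Fin (suc k) → Fin (suc k) → ℚ) → Fin (suc k) → ℚ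
edgesFrom k ρ F.zero = edges k ρ
edgesFrom (suc k) ρ (F.suc a) = edgesFrom k (λ a b → ρ (F.suc a) (F.suc b)) a

edges-mono : ∀ k {ρ σ} → (∀ a b → ρ a b ≤ σ a b) → edges k ρ ≤ edges k σ
edges-mono zero le = ≤-refl
edges-mono (suc k) le = +-mono-≤ (le _ _) (edges-mono k (λ a b → le (F.suc a) (F.suc b)))

edges-sumFin : ∀ k n (ρ : Fin n → Fin (suc k) → Fin (suc k) → ℚ) →
  edges k (λ a b → sumFin n (λ i → ρ i a b)) ≡ sumFin n (λ i → edges k (ρ i))
edges-sumFin zero n ρ = sym (sumFin-zero n (λ _ → refl))
edges-sumFin (suc k) n ρ = trans (cong (sumFin n _ +_) (edges-sumFin k n (λ i a b → ρ i (F.suc a) (F.suc b)))) (sym (sumFin-+ n _ _))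

edges-* : ∀ k c ρ → edges k (λ a b → c * ρ a b) ≡ c * edges k ρ
edges-* zero c ρ = sym (*-zeroʳ c)
edges-* (suc k) c ρ = trans (cong (c * ρ (F.suc F.zero) F.zero +_) (edges-* k c (λ a b → ρ (F.suc a) (F.suc b)))) (sym (*-distribˡ-+ c _ _))

0≤edges : ∀ k {ρ} → (∀ a b → 0ℚ ≤ ρ a b) → 0ℚ ≤ edges k ρ
0≤edges zero le = ≤-refl
0≤edges (suc k) le = +-nonNeg (le _ _) (0≤edges k (λ a b → le (F.suc a) (F.suc b)))

0≤edgesFrom : ∀ k {ρ} → (∀ a b → 0ℚ ≤ ρ a b) → ∀ a → 0ℚ ≤ edgesFrom k ρ a
0≤edgesFrom k le F.zero = 0≤edges k le
0≤edgesFrom (suc k) le (F.suc a) = 0≤edgesFrom k (λ a b → le (F.suc a) (F.suc b)) a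

-- `edgesFrom` acts as a potential, the part of the path still ahead: raising z by one either stays
-- in a cell, where ρ vanishes, or crosses one edge.
edgesFrom-step : ∀ q .{{_ : NonZero q}} k ρ → (∀ a → ρ a a ≡ 0ℚ) → ∀ z →
  ρ (step q k (suc z)) (step q k z) + edgesFrom k ρ (step q k (suc z)) ≡ edgesFrom k ρ (step q k z)
edgesFrom-step q zero ρ ρ≡0 z = trans (+-identityʳ (ρ F.zero F.zero)) (ρ≡0 F.zero)
edgesFrom-step q (suc k) ρ ρ≡0 z with z ℕ.<? q | suc z ℕ.<? q
... | yes _ | yes _ = trans (cong (_+ edges (suc k) ρ) (ρ≡0 F.zero)) (+-identityˡ (edges (suc k) ρ))
... | yes z<q | no 1+z≮q rewrite ℕₚ.m≤n⇒m∸n≡0 z<q | step-start q k = refl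
... | no z≮q | yes 1+z<q = ⊥-elim (z≮q (ℕₚ.<-trans (ℕₚ.n<1+n z) 1+z<q))
... | no z≮q | no _ rewrite ℕₚ.+-∸-assoc 1 (ℕₚ.≮⇒≥ z≮q) = edgesFrom-step q k (λ a b → ρ (F.suc a) (F.suc b)) (λ a → ρ≡0 (F.suc a)) (z ℕ.∸ q)

variation : ∀ {A : Set} → (A → ℚ) → A → A → ℚ
variation h x y = ∣ h x - h y ∣

-- Since `step` is monotone, no edge is crossed twice. Hence neither `L` nor `q` enters the bound,
-- and the number of bits will not enter the influences.
tvℕ-step≤edgesFrom : ∀ q .{{_ : NonZero q}} k G o L → tvℕ (λ z → G (step q k z)) o L ≤ edgesFrom k (variation G) (step q k o)
tvℕ-step≤edgesFrom q k G o zero = 0≤edgesFrom k (λ a b → 0≤∣p∣ (G a - G b)) (step q k o)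
tvℕ-step≤edgesFrom q k G o (suc L) = ≤-trans (+-monoʳ-≤ (variation G (step q k (suc o)) (step q k o)) (tvℕ-step≤edgesFrom q k G (suc o) L))
  (≤-reflexive (edgesFrom-step q k (variation G) (λ a → ∣a-a∣≡0 (G a)) o))

block : ∀ (q k s : ℕ) → Vec Bool s → Fin (suc k)
block q k s u = step q k (num u)

bit-variation≤edges : ∀ q .{{_ : NonZero q}} k s (G : Fin (suc k) → ℚ) →
  sumFin s (λ r → 𝔼 s (λ u → ∣ D r (λ u′ → G (block q k s u′)) u ∣)) ≤ edges k (variation G)
bit-variation≤edges q k s G = begin
  sumFin s (λ r → 𝔼 s (λ u → ∣ D r (λ u′ → G (block q k s u′)) u ∣)) ≡⟨ sumFin-cong s (λ r → ∣D∣-cong r (λ u → cong (λ z → G (step q k z)) (sym (ℕₚ.+-identityʳ (num u))))) ⟩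
  sumFin s (λ r → 𝔼 s (λ u → ∣ D r (λ u′ → G (step q k (num u′ ℕ.+ 0))) u ∣)) ≤⟨ bit-variation≤tvℕ s (λ z → G (step q k z)) 0 ⟩
  tvℕ (λ z → G (step q k z)) 0 (2 ℕ.^ s) ≤⟨ tvℕ-step≤edgesFrom q k G 0 (2 ℕ.^ s) ⟩
  edgesFrom k (variation G) (step q k 0) ≡⟨ cong (edgesFrom k (variation G)) (step-start q k) ⟩
  edges k (variation G) ∎
  where open ≤-Reasoning

sumℕ : (ℕ → ℚ) → ℕ → ℕ → ℚ
sumℕ κ o zero = 0ℚ
sumℕ κ o (suc L) = κ o + sumℕ κ (suc o) L

sumℕ-+ : ∀ κ o a b → sumℕ κ o (a ℕ.+ b) ≡ sumℕ κ o a + sumℕ κ (a ℕ.+ o) b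
sumℕ-+ κ o zero b = sym (+-identityˡ (sumℕ κ o b))
sumℕ-+ κ o (suc a) b = trans (cong (κ o +_) (trans (sumℕ-+ κ (suc o) a b)
  (cong (λ z → sumℕ κ (suc o) a + sumℕ κ z b) (ℕₚ.+-suc a o)))) (sym (+-assoc (κ o) _ _))

𝔼-num : ∀ s κ o → ι (2 ℕ.^ s) * 𝔼 s (λ u → κ (num u ℕ.+ o)) ≡ sumℕ κ o (2 ℕ.^ s)
𝔼-num zero κ o = trans (*-identityˡ (κ o)) (sym (+-identityʳ (κ o)))
𝔼-num (suc s) κ o = begin
  ι (M ℕ.+ (M ℕ.+ 0)) * (½ * (e₀ + e₁)) ≡⟨ cong (λ z → ι (M ℕ.+ z) * (½ * (e₀ + e₁))) (ℕₚ.+-identityʳ M) ⟩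
  ι (M ℕ.+ M) * (½ * (e₀ + e₁)) ≡⟨ cong (_* (½ * (e₀ + e₁))) (ι-+ M M) ⟩
  (ι M + ι M) * (½ * (e₀ + e₁)) ≡⟨ solve 3 (λ m a b → (m :+ m) :* (con ½ :* (a :+ b)) := m :* a :+ m :* b) refl (ι M) e₀ e₁ ⟩
  ι M * e₀ + ι M * e₁ ≡⟨ cong₂ _+_ (𝔼-num s κ o) (trans (cong (ι M *_) (𝔼-cong s (λ u → cong κ (trans (cong (ℕ._+ o) (ℕₚ.+-comm M (num u))) (ℕₚ.+-assoc (num u) M o))))) (𝔼-num s κ (M ℕ.+ o))) ⟩
  sumℕ κ o M + sumℕ κ (M ℕ.+ o) M ≡⟨ sym (sumℕ-+ κ o M M) ⟩
  sumℕ κ o (M ℕ.+ M) ≡⟨ cong (λ z → sumℕ κ o (M ℕ.+ z)) (sym (ℕₚ.+-identityʳ M)) ⟩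
  sumℕ κ o (M ℕ.+ (M ℕ.+ 0)) ∎
  where
  open ≡-Reasoning
  M = 2 ℕ.^ s
  e₀ = 𝔼 s (λ u → κ (num u ℕ.+ o))
  e₁ = 𝔼 s (λ u → κ (M ℕ.+ num u ℕ.+ o))

sumℕ-≥ : ∀ κ o L c → (∀ z → z ℕ.< L ℕ.+ o → c ≤ κ z) → ι L * c ≤ sumℕ κ o L
sumℕ-≥ κ o zero c le = ≤-reflexive (*-zeroˡ c)
sumℕ-≥ κ o (suc L) c le = ≤-trans
  (≤-reflexive (trans (cong (_* c) (ι-suc L)) (solve 2 (λ l c → (con 1ℚ :+ l) :* c := c :+ l :* c) refl (ι L) c)))
  (+-mono-≤ (le o (s≤s (ℕₚ.m≤n+m o L))) (sumℕ-≥ κ (suc o) L c (λ z z< → le z (subst (z ℕ.<_) (ℕₚ.+-suc L o) z<))))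

sumℕ-shift : ∀ κ a o L → sumℕ κ (a ℕ.+ o) L ≡ sumℕ (λ z → κ (a ℕ.+ z)) o L
sumℕ-shift κ a o zero = refl
sumℕ-shift κ a o (suc L) = cong (κ (a ℕ.+ o) +_) (trans (cong (λ z → sumℕ κ z L) (sym (ℕₚ.+-suc a o))) (sumℕ-shift κ a (suc o) L))

sumℕ-cong : ∀ {κ κ′} o L → (∀ z → κ z ≡ κ′ z) → sumℕ κ o L ≡ sumℕ κ′ o L
sumℕ-cong o zero eq = refl
sumℕ-cong o (suc L) eq = cong₂ _+_ (eq o) (sumℕ-cong (suc o) L eq)

-- Every cell is hit at least q times; the surplus r falls on the last cell and only helps, as G is
-- nonnegative.
sumFin≤sumℕ-step : ∀ q k (G : Fin (suc k) → ℚ) → (∀ a → 0ℚ ≤ G a) → ∀ r →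
  ι q * sumFin (suc k) G ≤ sumℕ (λ z → G (step q k z)) 0 (suc k ℕ.* q ℕ.+ r)
sumFin≤sumℕ-step q zero G 0≤G r = begin
  ι q * (G F.zero + 0ℚ) ≡⟨ cong (ι q *_) (+-identityʳ (G F.zero)) ⟩
  ι q * G F.zero ≤⟨ *-monoʳ (0≤G F.zero) (ι-mono (ℕₚ.≤-trans (ℕₚ.m≤m+n q 0) (ℕₚ.m≤m+n (q ℕ.+ 0) r))) ⟩
  ι (q ℕ.+ 0 ℕ.+ r) * G F.zero ≤⟨ sumℕ-≥ (λ _ → G F.zero) 0 (q ℕ.+ 0 ℕ.+ r) (G F.zero) (λ _ _ → ≤-refl) ⟩
  sumℕ (λ z → G (step q zero z)) 0 (q ℕ.+ 0 ℕ.+ r) ∎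
  where open ≤-Reasoning
sumFin≤sumℕ-step q (suc k) G 0≤G r = begin
  ι q * (G F.zero + sumFin (suc k) (λ a → G (F.suc a))) ≡⟨ *-distribˡ-+ (ι q) (G F.zero) _ ⟩
  ι q * G F.zero + ι q * sumFin (suc k) (λ a → G (F.suc a)) ≤⟨ +-mono-≤
    (sumℕ-≥ κ 0 q (G F.zero) (λ z z<q → ≤-reflexive (cong G (sym (step-first q (suc k) z (subst (z ℕ.<_) (ℕₚ.+-identityʳ q) z<q))))))
    (sumFin≤sumℕ-step q k (λ a → G (F.suc a)) (λ a → 0≤G (F.suc a)) r) ⟩
  sumℕ κ 0 q + sumℕ (λ z → G (F.suc (step q k z))) 0 L ≡⟨ cong (sumℕ κ 0 q +_) (sumℕ-cong 0 L (λ z → cong G (sym (step-shift q k z)))) ⟩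
  sumℕ κ 0 q + sumℕ (λ z → κ (q ℕ.+ z)) 0 L ≡⟨ cong (sumℕ κ 0 q +_) (sym (sumℕ-shift κ q 0 L)) ⟩
  sumℕ κ 0 q + sumℕ κ (q ℕ.+ 0) L ≡⟨ sym (sumℕ-+ κ 0 q L) ⟩
  sumℕ κ 0 (q ℕ.+ L) ≡⟨ cong (sumℕ κ 0) (sym (ℕₚ.+-assoc q (suc k ℕ.* q) r)) ⟩
  sumℕ κ 0 (suc (suc k) ℕ.* q ℕ.+ r) ∎
  where
  open ≤-Reasoning
  κ = λ z → G (step q (suc k) z)
  L = suc k ℕ.* q ℕ.+ r

sumFin≤𝔼-block : ∀ q k s → suc k ℕ.* q ℕ.≤ 2 ℕ.^ s → (G : Fin (suc k) → ℚ) → (∀ a → 0ℚ ≤ G a) →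
  ι q * sumFin (suc k) G ≤ ι (2 ℕ.^ s) * 𝔼 s (λ u → G (block q k s u))
sumFin≤𝔼-block q k s le G 0≤G = begin
  ι q * sumFin (suc k) G ≤⟨ sumFin≤sumℕ-step q k G 0≤G (2 ℕ.^ s ℕ.∸ suc k ℕ.* q) ⟩
  sumℕ κ 0 (suc k ℕ.* q ℕ.+ (2 ℕ.^ s ℕ.∸ suc k ℕ.* q)) ≡⟨ cong (sumℕ κ 0) (ℕₚ.m+[n∸m]≡n le) ⟩
  sumℕ κ 0 (2 ℕ.^ s) ≡⟨ sym (𝔼-num s κ 0) ⟩
  ι (2 ℕ.^ s) * 𝔼 s (λ u → κ (num u ℕ.+ 0)) ≡⟨ cong (ι (2 ℕ.^ s) *_) (𝔼-cong s (λ u → cong κ (ℕₚ.+-identityʳ (num u)))) ⟩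
  ι (2 ℕ.^ s) * 𝔼 s (λ u → κ (num u)) ∎
  where
  open ≤-Reasoning
  κ = λ z → G (step q k z)

-- The product encoding of [k]ⁿ

∅ : ∀ {k} → Cube k 0
∅ ()

∥_-_∥ : ∀ {k n} → Cube k n → Cube k n → ℚ
∥_-_∥ {n = n} x y = sumFin n (λ i → ∣ val (x i) - val (y i) ∣)

edges-unit≤ : ∀ l (ρ : Fin (suc l) → Fin (suc l) → ℚ) c → (∀ a b → ρ a b ≤ c * ∣ val a - val b ∣) → edges l ρ ≤ ι l * c
edges-unit≤ zero ρ c le = ≤-reflexive (sym (*-zeroˡ c))
edges-unit≤ (suc l) ρ c le = ≤-trans (+-mono-≤ (le _ _) (edges-unit≤ l _ c le′))
  (≤-reflexive (trans (solve 2 (λ l c → c :* con 1ℚ :+ l :* c := (con 1ℚ :+ l) :* c) refl (ι l) c) (cong (_* c) (sym (ι-suc l)))))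
  where
  le′ : ∀ a b → ρ (F.suc a) (F.suc b) ≤ c * ∣ val a - val b ∣
  le′ a b = subst (λ z → ρ (F.suc a) (F.suc b) ≤ c * ∣ z ∣)
    (trans (cong₂ _-_ (ι-suc (toℕ a)) (ι-suc (toℕ b))) (solve 2 (λ a b → con 1ℚ :+ a :- (con 1ℚ :+ b) := a :- b) refl (val a) (val b)))
    (le (F.suc a) (F.suc b))

take-++ : ∀ {m n} (u : Vec Bool m) (v : Vec Bool n) → V.take m (u ++ v) ≡ u
take-++ [] v = refl
take-++ (x ∷ u) v = cong (x ∷_) (take-++ u v)

drop-++ : ∀ {m n} (u : Vec Bool m) (v : Vec Bool n) → V.drop m (u ++ v) ≡ v
drop-++ [] v = refl
drop-++ (x ∷ u) v = drop-++ u v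

flip-++ˡ : ∀ {m n} (r : Fin m) (u : Vec Bool m) (v : Vec Bool n) → (u ++ v) [ r ↑ˡ n ]%= not ≡ (u [ r ]%= not) ++ v
flip-++ˡ F.zero (x ∷ u) v = refl
flip-++ˡ (F.suc r) (x ∷ u) v = cong (x ∷_) (flip-++ˡ r u v)

flip-++ʳ : ∀ {m n} (r : Fin n) (u : Vec Bool m) (v : Vec Bool n) → (u ++ v) [ m ↑ʳ r ]%= not ≡ u ++ (v [ r ]%= not)
flip-++ʳ r [] v = refl
flip-++ʳ r (x ∷ u) v = cong (x ∷_) (flip-++ʳ r u v)

cond-true-++ : ∀ {t N} (J : Vec Bool N) (f : Fun (t ℕ.+ N)) u v → cond (replicate t true ++ J) f (u ++ v) ≡ cond J (λ w → f (u ++ w)) v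
cond-true-++ J f [] v = refl
cond-true-++ J f (x ∷ u) v = cond-true-++ J (λ w → f (x ∷ w)) u v

cond-false-++ : ∀ {t N} (J : Vec Bool N) (f : Fun (t ℕ.+ N)) (u : Vec Bool t) v →
  cond (replicate t false ++ J) f (u ++ v) ≡ 𝔼 t (λ u′ → cond J (λ w → f (u′ ++ w)) v)
cond-false-++ J f [] v = refl
cond-false-++ {suc t} J f (x ∷ u) v = trans (cond-false-++ J (avg f) u v)
  (trans (𝔼-cong t (λ u′ → trans (cond-* J ½ _ v) (cong (½ *_) (cond-+ J _ _ v))))
    (trans (𝔼-* t ½ _) (cong (½ *_) (𝔼-+ t _ _))))

module _ {s k : ℕ} (φ : Vec Bool s → Fin (suc k)) where

  ψ : ∀ n → Vec Bool (n ℕ.* s) → Cube (suc k) n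
  ψ zero w = ∅
  ψ (suc n) w = φ (V.take s w) ∷ᶠ ψ n (V.drop s w)

  ψ-++ : ∀ n u v → ψ (suc n) (u ++ v) ≡ φ u ∷ᶠ ψ n v
  ψ-++ n u v = cong₂ (λ a b → φ a ∷ᶠ ψ n b) (take-++ u v) (drop-++ u v)

  𝔼-ψ : ∀ n (h : Cube (suc k) (suc n) → ℚ) →
    𝔼 (suc n ℕ.* s) (λ w → h (ψ (suc n) w)) ≡ 𝔼 s (λ u → 𝔼 (n ℕ.* s) (λ v → h (φ u ∷ᶠ ψ n v)))
  𝔼-ψ n h = trans (𝔼-++ s (n ℕ.* s) _) (𝔼-cong s (λ u → 𝔼-cong (n ℕ.* s) (λ v → cong h (ψ-++ n u v))))

  -- Domination of measures passes to products. The one-coordinate bound is assumed for every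
  -- nonnegative G because the induction applies it to inner expectations.
  sumCube≤𝔼 : ∀ {c} → 0ℚ ≤ c → (∀ (G : Fin (suc k) → ℚ) → (∀ a → 0ℚ ≤ G a) → c * sumFin (suc k) G ≤ 𝔼 s (λ u → G (φ u))) →
    ∀ n (F : Cube (suc k) n → ℚ) → (∀ x → 0ℚ ≤ F x) → (∀ x y → (∀ i → x i ≡ y i) → F x ≡ F y) →
    pow c n * sumCube (suc k) n F ≤ 𝔼 (n ℕ.* s) (λ w → F (ψ n w))
  -- The empty point inside `sumCube` and `∅` agree only pointwise, which is where `ext` comes in.
  sumCube≤𝔼 0≤c bound zero F 0≤F ext = ≤-reflexive (trans (*-identityˡ _) (ext _ _ λ ()))
  sumCube≤𝔼 {c} 0≤c bound (suc n) F 0≤F ext = begin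
    c * pow c n * sumFin (suc k) S ≡⟨ *-assoc c (pow c n) (sumFin (suc k) S) ⟩
    c * (pow c n * sumFin (suc k) S) ≡⟨ cong (c *_) (sym (sumFin-* (suc k) (pow c n) S)) ⟩
    c * sumFin (suc k) (λ a → pow c n * S a) ≤⟨ *-monoˡ 0≤c (sumFin-mono (suc k) (λ a →
      sumCube≤𝔼 0≤c bound n (λ x → F (a ∷ᶠ x)) (λ x → 0≤F (a ∷ᶠ x)) (λ x y x≡y → ext (a ∷ᶠ x) (a ∷ᶠ y) (λ { F.zero → refl ; (F.suc i) → x≡y i })))) ⟩
    c * sumFin (suc k) (λ a → 𝔼 (n ℕ.* s) (λ v → F (a ∷ᶠ ψ n v))) ≤⟨ bound _ (λ a → 𝔼-nonNeg (n ℕ.* s) (λ v → 0≤F (a ∷ᶠ ψ n v))) ⟩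
    𝔼 s (λ u → 𝔼 (n ℕ.* s) (λ v → F (φ u ∷ᶠ ψ n v))) ≡⟨ sym (𝔼-ψ n F) ⟩
    𝔼 (suc n ℕ.* s) (λ w → F (ψ (suc n) w)) ∎
    where
    open ≤-Reasoning
    S = λ a → sumCube (suc k) n (λ x → F (a ∷ᶠ x))

  -- The expectation of the sum of ρ over the consecutive pairs on a line in direction j.
  lineSum : ∀ n → Fin n → (Cube (suc k) n → Cube (suc k) n → ℚ) → ℚ
  lineSum (suc n) F.zero ρ = 𝔼 (n ℕ.* s) (λ v → edges k (λ a b → ρ (a ∷ᶠ ψ n v) (b ∷ᶠ ψ n v)))
  lineSum (suc n) (F.suc j) ρ = 𝔼 s (λ u → lineSum n j (λ x y → ρ (φ u ∷ᶠ x) (φ u ∷ᶠ y)))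

  lineSum-mono : ∀ n j {ρ σ} → (∀ x y → ρ x y ≤ σ x y) → lineSum n j ρ ≤ lineSum n j σ
  lineSum-mono (suc n) F.zero le = 𝔼-mono (n ℕ.* s) (λ v → edges-mono k (λ a b → le _ _))
  lineSum-mono (suc n) (F.suc j) le = 𝔼-mono s (λ u → lineSum-mono n j (λ x y → le _ _))

  0≤lineSum : ∀ n j {ρ} → (∀ x y → 0ℚ ≤ ρ x y) → 0ℚ ≤ lineSum n j ρ
  0≤lineSum (suc n) F.zero le = 𝔼-nonNeg (n ℕ.* s) (λ v → 0≤edges k (λ a b → le _ _))
  0≤lineSum (suc n) (F.suc j) le = 𝔼-nonNeg s (λ u → 0≤lineSum n j (λ x y → le _ _))

  lineSum-sumFin : ∀ n j m (ρ : Fin m → Cube (suc k) n → Cube (suc k) n → ℚ) →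
    lineSum n j (λ x y → sumFin m (λ i → ρ i x y)) ≡ sumFin m (λ i → lineSum n j (ρ i))
  lineSum-sumFin (suc n) F.zero m ρ = trans (𝔼-cong (n ℕ.* s) (λ v → edges-sumFin k m _)) (𝔼-sumFin (n ℕ.* s) m _)
  lineSum-sumFin (suc n) (F.suc j) m ρ = trans (𝔼-cong s (λ u → lineSum-sumFin n j m _)) (𝔼-sumFin s m _)

  lineSum-* : ∀ n j c ρ → lineSum n j (λ x y → c * ρ x y) ≡ c * lineSum n j ρ
  lineSum-* (suc n) F.zero c ρ = trans (𝔼-cong (n ℕ.* s) (λ v → edges-* k c _)) (𝔼-* (n ℕ.* s) c _)
  lineSum-* (suc n) (F.suc j) c ρ = trans (𝔼-cong s (λ u → lineSum-* n j c _)) (𝔼-* s c _)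

  -- A line has k edges, each joining points at unnormalised distance 1, since the other coordinates
  -- cancel.
  lineSum≤ : ∀ n j (ρ : Cube (suc k) n → Cube (suc k) n → ℚ) c → (∀ x y → ρ x y ≤ c * ∥ x - y ∥) → lineSum n j ρ ≤ ι k * c
  lineSum≤ (suc n) F.zero ρ c le = ≤-trans (𝔼-mono (n ℕ.* s) (λ v → edges-unit≤ k _ c (λ a b →
      ≤-trans (le (a ∷ᶠ ψ n v) (b ∷ᶠ ψ n v)) (≤-reflexive (cong (c *_) (trans (cong (∣ val a - val b ∣ +_)
        (sumFin-zero n (λ i → ∣a-a∣≡0 (val (ψ n v i))))) (+-identityʳ ∣ val a - val b ∣)))))))
    (≤-reflexive (𝔼-const (n ℕ.* s) (ι k * c)))
  lineSum≤ (suc n) (F.suc j) ρ c le = ≤-trans (𝔼-mono s (λ u → lineSum≤ n j _ c (λ x y →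
      ≤-trans (le (φ u ∷ᶠ x) (φ u ∷ᶠ y)) (≤-reflexive (cong (c *_) (trans (cong (_+ ∥ x - y ∥)
        (∣a-a∣≡0 (val (φ u)))) (+-identityˡ ∥ x - y ∥)))))))
    (≤-reflexive (𝔼-const s (ι k * c)))

  module _ (bits≤ : ∀ G → sumFin s (λ r → 𝔼 s (λ u → ∣ D r (λ u′ → G (φ u′)) u ∣)) ≤ edges k (variation G)) where

    -- With all other coordinates fixed, h is a function of one coordinate and `bits≤` applies; the
    -- rest is the exchange of expectations.
    blockInfluence≤lineSum : ∀ n (j : Fin n) (h : Cube (suc k) n → ℚ) →
      sumFin s (λ r → 𝔼 (n ℕ.* s) (λ w → ∣ D (combine j r) (λ w′ → h (ψ n w′)) w ∣)) ≤ lineSum n j (variation h)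
    blockInfluence≤lineSum (suc n) F.zero h = begin
      sumFin s (λ r → 𝔼 (suc n ℕ.* s) (λ w → ∣ D (r ↑ˡ (n ℕ.* s)) (λ w′ → h (ψ (suc n) w′)) w ∣)) ≡⟨ sumFin-cong s (λ r → trans (𝔼-++ s (n ℕ.* s) _)
        (trans (𝔼-cong s (λ u → 𝔼-cong (n ℕ.* s) (λ v → pt r u v))) (𝔼-comm s (n ℕ.* s) _))) ⟩
      sumFin s (λ r → 𝔼 (n ℕ.* s) (λ v → 𝔼 s (λ u → ∣ D r (λ u′ → h (φ u′ ∷ᶠ ψ n v)) u ∣))) ≡⟨ sym (𝔼-sumFin (n ℕ.* s) s _) ⟩
      𝔼 (n ℕ.* s) (λ v → sumFin s (λ r → 𝔼 s (λ u → ∣ D r (λ u′ → h (φ u′ ∷ᶠ ψ n v)) u ∣))) ≤⟨ 𝔼-mono (n ℕ.* s) (λ v → bits≤ (λ a → h (a ∷ᶠ ψ n v))) ⟩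
      lineSum (suc n) F.zero (variation h) ∎
      where
      open ≤-Reasoning
      pt : ∀ r u v → ∣ D (r ↑ˡ (n ℕ.* s)) (λ w′ → h (ψ (suc n) w′)) (u ++ v) ∣ ≡ ∣ D r (λ u′ → h (φ u′ ∷ᶠ ψ n v)) u ∣
      pt r u v = cong₂ (λ x y → ∣ ½ * (h x - h y) ∣) (ψ-++ n u v)
        (trans (cong (ψ (suc n)) (flip-++ˡ r u v)) (ψ-++ n (u [ r ]%= not) v))
    blockInfluence≤lineSum (suc n) (F.suc j) h = begin
      sumFin s (λ r → 𝔼 (suc n ℕ.* s) (λ w → ∣ D (s ↑ʳ combine j r) (λ w′ → h (ψ (suc n) w′)) w ∣)) ≡⟨ sumFin-cong s (λ r → trans (𝔼-++ s (n ℕ.* s) _)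
        (𝔼-cong s (λ u → 𝔼-cong (n ℕ.* s) (λ v → pt r u v)))) ⟩
      sumFin s (λ r → 𝔼 s (λ u → 𝔼 (n ℕ.* s) (λ v → ∣ D (combine j r) (λ v′ → h (φ u ∷ᶠ ψ n v′)) v ∣))) ≡⟨ sym (𝔼-sumFin s s _) ⟩
      𝔼 s (λ u → sumFin s (λ r → 𝔼 (n ℕ.* s) (λ v → ∣ D (combine j r) (λ v′ → h (φ u ∷ᶠ ψ n v′)) v ∣))) ≤⟨ 𝔼-mono s (λ u → blockInfluence≤lineSum n j (λ x → h (φ u ∷ᶠ x))) ⟩
      lineSum (suc n) (F.suc j) (variation h) ∎
      where
      open ≤-Reasoning
      pt : ∀ r u v → ∣ D (s ↑ʳ combine j r) (λ w′ → h (ψ (suc n) w′)) (u ++ v) ∣ ≡ ∣ D (combine j r) (λ v′ → h (φ u ∷ᶠ ψ n v′)) v ∣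
      pt r u v = cong₂ (λ x y → ∣ ½ * (h x - h y) ∣) (ψ-++ n u v)
        (trans (cong (ψ (suc n)) (flip-++ʳ (combine j r) u v)) (ψ-++ n u (v [ combine j r ]%= not)))

  blocks : ∀ {n} → Vec Bool n → Vec Bool (n ℕ.* s)
  blocks [] = []
  blocks (b ∷ J) = replicate s b ++ blocks J

  lookup-blocks : ∀ {n} (J : Vec Bool n) j r → lookup (blocks J) (combine j r) ≡ lookup J j
  lookup-blocks (b ∷ J) F.zero r = trans (lookup-++ˡ (replicate s b) (blocks J) r) (lookup-replicate r b)
  lookup-blocks (b ∷ J) (F.suc j) r = trans (lookup-++ʳ (replicate s b) (blocks J) (combine j r)) (lookup-blocks J j r)

  -- The conditional expectation transported to the cube, where free coordinates follow the law of φ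
  -- rather than the uniform one. Working with points of the cube makes the dependence on J alone
  -- visible.
  condCube : ∀ {n} → Vec Bool n → (Cube (suc k) n → ℚ) → Cube (suc k) n → ℚ
  condCube [] h x = h ∅
  condCube (true ∷ J) h x = condCube J (λ y → h (x F.zero ∷ᶠ y)) (λ i → x (F.suc i))
  condCube (false ∷ J) h x = 𝔼 s (λ u → condCube J (λ y → h (φ u ∷ᶠ y)) (λ i → x (F.suc i)))

  condCube-junta : ∀ {n} (J : Vec Bool n) h x y → (∀ j → lookup J j ≡ true → x j ≡ y j) → condCube J h x ≡ condCube J h y
  condCube-junta [] h x y eq = refl
  condCube-junta (true ∷ J) h x y eq = trans (cong (λ a → condCube J (λ z → h (a ∷ᶠ z)) (λ i → x (F.suc i))) (eq F.zero refl))
    (condCube-junta J _ _ _ (λ j → eq (F.suc j)))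
  condCube-junta (false ∷ J) h x y eq = 𝔼-cong s (λ u → condCube-junta J _ _ _ (λ j → eq (F.suc j)))

  -- `blocks J` contains all the bits of a coordinate or none of them, so conditioning on bits never
  -- splits a coordinate.
  cond-blocks : ∀ n (J : Vec Bool n) h w → cond (blocks J) (λ w′ → h (ψ n w′)) w ≡ condCube J h (ψ n w)
  cond-blocks zero [] h [] = refl
  cond-blocks (suc n) (b ∷ J) h w = subst (λ z → cond (replicate s b ++ blocks J) hψ z ≡ condCube (b ∷ J) h (ψ (suc n) w))
    (take++drop≡id s w) (lemma b)
    where
    hψ : Fun (suc n ℕ.* s)
    hψ w′ = h (ψ (suc n) w′)
    u = V.take s w
    v = V.drop s w
    inner : ∀ u′ → cond (blocks J) (λ w′ → hψ (u′ ++ w′)) v ≡ condCube J (λ y → h (φ u′ ∷ᶠ y)) (ψ n v)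
    inner u′ = trans (cond-cong (blocks J) (λ w′ → cong h (ψ-++ n u′ w′)) v) (cond-blocks n J (λ y → h (φ u′ ∷ᶠ y)) v)
    lemma : ∀ b → cond (replicate s b ++ blocks J) hψ (u ++ v) ≡ condCube (b ∷ J) h (ψ (suc n) w)
    lemma true = trans (cond-true-++ (blocks J) hψ u v) (inner u)
    lemma false = trans (cond-false-++ (blocks J) hψ u v) (𝔼-cong s inner)

-- Thresholds and rounding

-- Thresholds take the values 0 and 2, so that their derivatives D j lie in {-1,0,1}.
thr : ∀ {l} → Fin l → Fin (suc l) → ℚ
thr t F.zero = 0ℚ
thr F.zero (F.suc a) = ι 2
thr (F.suc t) (F.suc a) = thr t a

thr-two : ∀ {l} (t : Fin l) a → thr t a ≡ 0ℚ ⊎ thr t a ≡ ι 2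
thr-two t F.zero = inj₁ refl
thr-two F.zero (F.suc a) = inj₂ refl
thr-two (F.suc t) (F.suc a) = thr-two t a

val-suc : ∀ {l} (a : Fin l) → val (F.suc a) ≡ 1ℚ + val a
val-suc a = ι-suc (toℕ a)

sum-thr : ∀ l (a : Fin (suc l)) → sumFin l (λ t → thr t a) ≡ ι 2 * val a
sum-thr l F.zero = trans (sumFin-zero l (λ t → refl)) (sym (*-zeroʳ (ι 2)))
sum-thr (suc l) (F.suc a) = trans (cong (ι 2 +_) (sum-thr l a))
  (trans (solve 1 (λ v → con (ι 2) :+ con (ι 2) :* v := con (ι 2) :* (con 1ℚ :+ v)) refl (val a)) (cong (ι 2 *_) (sym (val-suc a))))

-- The co-area formula: the thresholds separating a from b are those lying between them, and each
-- contributes 2. Hence cutting into thresholds costs no factor of l in total variation.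
sum-thr-variation : ∀ l (a b : Fin (suc l)) → sumFin l (λ t → ∣ thr t a - thr t b ∣) ≡ ι 2 * ∣ val a - val b ∣
sum-thr-variation l a F.zero = begin
  sumFin l (λ t → ∣ thr t a - 0ℚ ∣) ≡⟨ sumFin-cong l (λ t → trans (cong ∣_∣ (+-identityʳ (thr t a))) (0≤p⇒∣p∣≡p (0≤thr t))) ⟩
  sumFin l (λ t → thr t a) ≡⟨ sum-thr l a ⟩
  ι 2 * val a ≡⟨ cong (ι 2 *_) (sym (trans (cong ∣_∣ (+-identityʳ (val a))) (0≤p⇒∣p∣≡p (0≤ι (toℕ a))))) ⟩
  ι 2 * ∣ val a - 0ℚ ∣ ∎
  where
  open ≡-Reasoning
  0≤thr : ∀ t → 0ℚ ≤ thr t a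
  0≤thr t with thr-two t a
  ... | inj₁ eq = ≤-reflexive (sym eq)
  ... | inj₂ eq = ≤-trans (0≤ι 2) (≤-reflexive (sym eq))
sum-thr-variation l F.zero b@(F.suc _) = trans (sumFin-cong l (λ t → ∣a-b∣≡∣b-a∣ 0ℚ (thr t b)))
  (trans (sum-thr-variation l b F.zero) (cong (ι 2 *_) (∣a-b∣≡∣b-a∣ (val b) 0ℚ)))
sum-thr-variation (suc l) (F.suc a) (F.suc b) = trans (+-identityˡ _) (trans (sum-thr-variation l a b) (cong (λ z → ι 2 * ∣ z ∣)
  (sym (trans (cong₂ _-_ (val-suc a) (val-suc b)) (solve 2 (λ a b → con 1ℚ :+ a :- (con 1ℚ :+ b) := a :- b) refl (val a) (val b))))))

bit : Bool → ℚ
bit true = 1ℚ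
bit false = 0ℚ

-- Counting the thresholds passed makes the value additive in them, so rounding errors can be
-- estimated one threshold at a time.
tally : ∀ l → (Fin l → Bool) → Fin (suc l)
tally zero c = F.zero
tally (suc l) c = if c F.zero then F.suc (tally l (λ t → c (F.suc t))) else F.inject₁ (tally l (λ t → c (F.suc t)))

tally-cong : ∀ l {c c′ : Fin l → Bool} → (∀ t → c t ≡ c′ t) → tally l c ≡ tally l c′
tally-cong zero eq = refl
tally-cong (suc l) eq = cong₂ (λ b a → if b then F.suc a else F.inject₁ a) (eq F.zero) (tally-cong l (λ t → eq (F.suc t)))

val-tally : ∀ l c → val (tally l c) ≡ sumFin l (λ t → bit (c t))
val-tally zero c = refl
val-tally (suc l) c with c F.zero
... | true = trans (val-suc (tally l (λ t → c (F.suc t)))) (cong (1ℚ +_) (val-tally l (λ t → c (F.suc t))))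
... | false = trans (cong ι (toℕ-inject₁ (tally l (λ t → c (F.suc t))))) (trans (val-tally l (λ t → c (F.suc t))) (sym (+-identityˡ _)))

atLeast1 : ℚ → Bool
atLeast1 γ = does (1ℚ ≤? γ)

1≤² : ∀ {x} → 1ℚ ≤ x → 1ℚ ≤ x ²
1≤² 1≤x = *-mono (≤-trans (nonNegative⁻¹ 1ℚ) 1≤x) (nonNegative⁻¹ 1ℚ) 1≤x 1≤x

-- The cut 1 is midway between 0 and 2. A wrong decision costs 1 and happens only if γ is at
-- distance at least 1 from h, so the squared distance pays for it.
round-error : ∀ h γ → h ≡ 0ℚ ⊎ h ≡ ι 2 → (d : Dec (1ℚ ≤ γ)) → ∣ ½ * h - bit (does d) ∣ ≤ (h - γ) ²
round-error h γ (inj₁ refl) (yes 1≤γ) = ≤-trans (1≤² 1≤γ) (≤-reflexive (solve 1 (λ g → g :* g := (con 0ℚ :- g) :* (con 0ℚ :- g)) refl γ))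
round-error h γ (inj₂ refl) (yes 1≤γ) = 0≤² (ι 2 - γ)
round-error h γ (inj₁ refl) (no 1≰γ) = 0≤² (0ℚ - γ)
round-error h γ (inj₂ refl) (no 1≰γ) = 1≤² (≤-excess (1ℚ - γ) (≤⇒0≤- (<⇒≤ (≰⇒> 1≰γ)))
  (solve 1 (λ g → con 1ℚ :+ (con 1ℚ :- g) := con (ι 2) :- g) refl γ))

rounding : ∀ l (a : Fin (suc l)) (γ : Fin l → ℚ) →
  ∣ val a - val (tally l (λ t → atLeast1 (γ t))) ∣ ≤ sumFin l (λ t → (thr t a - γ t) ²)
rounding l a γ = begin
  ∣ val a - val (tally l c) ∣ ≡⟨ cong ∣_∣ eq ⟩
  ∣ sumFin l (λ t → ½ * thr t a - bit (c t)) ∣ ≤⟨ ∣sumFin∣≤ l _ ⟩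
  sumFin l (λ t → ∣ ½ * thr t a - bit (c t) ∣) ≤⟨ sumFin-mono l (λ t → round-error (thr t a) (γ t) (thr-two t a) (1ℚ ≤? γ t)) ⟩
  sumFin l (λ t → (thr t a - γ t) ²) ∎
  where
  open ≤-Reasoning
  c : Fin l → Bool
  c t = atLeast1 (γ t)
  eq : val a - val (tally l c) ≡ sumFin l (λ t → ½ * thr t a - bit (c t))
  eq = sym (trans (sumFin-+ l (λ t → ½ * thr t a) (λ t → - bit (c t))) (cong₂ _+_
    (trans (sumFin-* l ½ (λ t → thr t a)) (trans (cong (½ *_) (sum-thr l a)) (solve 1 (λ v → con ½ :* (con (ι 2) :* v) := v) refl (val a))))
    (trans (sumFin-cong l (λ t → solve 1 (λ b → :- b := con (- 1ℚ) :* b) refl (bit (c t))))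
      (trans (sumFin-* l (- 1ℚ) (λ t → bit (c t))) (trans (cong (- 1ℚ *_) (sym (val-tally l c))) (solve 1 (λ b → con (- 1ℚ) :* b := :- b) refl (val (tally l c))))))))

-- Sets of large weights and Markov's inequality

exceeding : ∀ n → (Fin n → ℚ) → ℚ → Subset n
exceeding n w θ = V.tabulate (λ i → does (θ <? w i))

notExceeding : ∀ n → (Fin n → ℚ) → ℚ → Subset n
notExceeding n w θ = V.tabulate (λ i → not (does (θ <? w i)))

exceeding-false : ∀ n w θ j → lookup (exceeding n w θ) j ≡ false → w j ≤ θ
exceeding-false (suc n) w θ F.zero = head (θ <? w F.zero)
  where
  head : (d : Dec (θ < w F.zero)) → does d ≡ false → w F.zero ≤ θ
  head (no θ≮w) _ = ≮⇒≥ θ≮w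
exceeding-false (suc n) w θ (F.suc j) = exceeding-false n (λ i → w (F.suc i)) θ j

notExceeding-true : ∀ n w θ j → lookup (notExceeding n w θ) j ≡ true → w j ≤ θ
notExceeding-true (suc n) w θ F.zero = head (θ <? w F.zero)
  where
  head : (d : Dec (θ < w F.zero)) → not (does d) ≡ true → w F.zero ≤ θ
  head (no θ≮w) _ = ≮⇒≥ θ≮w
notExceeding-true (suc n) w θ (F.suc j) = notExceeding-true n (λ i → w (F.suc i)) θ j

size-exceeding+notExceeding : ∀ n w θ → size (exceeding n w θ) ℕ.+ size (notExceeding n w θ) ≡ n
size-exceeding+notExceeding zero w θ = refl
size-exceeding+notExceeding (suc n) w θ = head (does (θ <? w F.zero))
  where
  w′ = λ i → w (F.suc i)
  head : ∀ b → size (b ∷ exceeding n w′ θ) ℕ.+ size (not b ∷ notExceeding n w′ θ) ≡ suc n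
  head true = cong suc (size-exceeding+notExceeding n w′ θ)
  head false = trans (ℕₚ.+-suc _ _) (cong suc (size-exceeding+notExceeding n w′ θ))

markov : ∀ n w θ → (∀ j → 0ℚ ≤ w j) → ι (size (exceeding n w θ)) * θ ≤ sumFin n w
markov zero w θ 0≤w = ≤-reflexive (*-zeroˡ θ)
markov (suc n) w θ 0≤w = head (θ <? w F.zero)
  where
  w′ = λ i → w (F.suc i)
  S = exceeding n w′ θ
  ih : ι (size S) * θ ≤ sumFin n w′
  ih = markov n w′ θ (λ j → 0≤w (F.suc j))
  head : (d : Dec (θ < w F.zero)) → ι (size (does d ∷ S)) * θ ≤ w F.zero + sumFin n w′
  head (yes θ<w) = ≤-trans (≤-reflexive (trans (cong (_* θ) (ι-suc (size S)))
      (solve 2 (λ s t → (con 1ℚ :+ s) :* t := t :+ s :* t) refl (ι (size S)) θ)))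
    (+-mono-≤ (<⇒≤ θ<w) ih)
  head (no _) = ≤-trans ih (≤-excess (w F.zero) (0≤w F.zero) (+-comm _ (w F.zero)))

-- Numerical parameters and the choice of the encoding

pow-1 : ∀ n → pow 1ℚ n ≡ 1ℚ
pow-1 zero = refl
pow-1 (suc n) = trans (*-identityˡ (pow 1ℚ n)) (pow-1 n)

ι≤pow2 : ∀ n → ι n ≤ pow (ι 2) n
ι≤pow2 zero = nonNegative⁻¹ 1ℚ
ι≤pow2 (suc n) = ≤-trans (≤-reflexive (ι-suc n)) (≤-trans (+-mono-≤ (1≤pow (ι-mono {1} {2} (s≤s z≤n)) n) (ι≤pow2 n))
  (≤-reflexive (solve 1 (λ x → x :+ x := con (ι 2) :* x) refl (pow (ι 2) n))))

1/6ℚ : ℚ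
1/6ℚ = ℤ.+ 1 / 6

-- The origin of 1/6: after the factor 3ᵈ of the level inequality there remains 2⁻ᵈ, which outweighs
-- d.
threshold≤1 : ∀ d → ι d * (pow 3ℚ d * pow 1/6ℚ d) ≤ 1ℚ
threshold≤1 d = begin
  ι d * (pow 3ℚ d * pow 1/6ℚ d) ≡⟨ cong (ι d *_) (sym (pow-* 3ℚ 1/6ℚ d)) ⟩
  ι d * pow ½ d ≤⟨ *-monoʳ (pow-nonNeg 0≤½ d) (ι≤pow2 d) ⟩
  pow (ι 2) d * pow ½ d ≡⟨ sym (pow-* (ι 2) ½ d) ⟩
  pow 1ℚ d ≡⟨ pow-1 d ⟩
  1ℚ ∎
  where open ≤-Reasoning

bernoulli : ∀ x n → 0ℚ ≤ x → 1ℚ - ι n * (1ℚ - x) ≤ pow x n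
bernoulli x zero 0≤x = ≤-reflexive (solve 1 (λ x → con 1ℚ :- con 0ℚ :* (con 1ℚ :- x) := con 1ℚ) refl x)
bernoulli x (suc n) 0≤x = begin
  1ℚ - ι (suc n) * (1ℚ - x) ≡⟨ cong (λ z → 1ℚ - z * (1ℚ - x)) (ι-suc n) ⟩
  1ℚ - (1ℚ + ι n) * (1ℚ - x) ≤⟨ ≤-excess (ι n * (1ℚ - x) ²) (*-nonNeg (0≤ι n) (0≤² (1ℚ - x)))
    (solve 2 (λ n x → con 1ℚ :- (con 1ℚ :+ n) :* (con 1ℚ :- x) :+ n :* ((con 1ℚ :- x) :* (con 1ℚ :- x)) := x :* (con 1ℚ :- n :* (con 1ℚ :- x))) refl (ι n) x) ⟩
  x * (1ℚ - ι n * (1ℚ - x)) ≤⟨ *-monoˡ 0≤x (bernoulli x n 0≤x) ⟩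
  x * pow x n ∎
  where open ≤-Reasoning

n≤2^n : ∀ n → n ℕ.≤ 2 ℕ.^ n
n≤2^n zero = z≤n
n≤2^n (suc n) = ℕₚ.+-mono-≤ {1} (ℕₚ.m^n>0 2 n) (ℕₚ.≤-trans (n≤2^n n) (ℕₚ.m≤m+n _ 0))

-- An interface hiding the length s: `bits≤` controls influences, while the fields on `weight` say
-- that the law of the encoding dominates half of the uniform measure on the cube.
record Encoding (k n : ℕ) : Set where
  field
    s : ℕ
    φ : Vec Bool s → Fin (suc k)
    bits≤ : ∀ G → sumFin s (λ r → 𝔼 s (λ u → ∣ D r (λ u′ → G (φ u′)) u ∣)) ≤ edges k (variation G)
    weight : ℚ
    0≤weight : 0ℚ ≤ weight
    weight≤ : ∀ (G : Fin (suc k) → ℚ) → (∀ a → 0ℚ ≤ G a) → weight * sumFin (suc k) G ≤ 𝔼 s (λ u → G (φ u))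
    1≤2·weightⁿ : 1ℚ ≤ ι 2 * (pow (ι (suc k)) n * pow weight n)

-- With 2ˢ ≥ 2 n k, each value of [k] has weight at least (1 - 1/(2n)) / k.
encoding : ∀ k n → Encoding k n
encoding k n = record
  { s = s ; φ = block q k s
  ; bits≤ = bit-variation≤edges q {{ℕ.>-nonZero (m≥n⇒m/n>0 {N} {suc k} k<N)}} k s
  ; weight = c ; 0≤weight = 0≤c ; weight≤ = weight≤′ ; 1≤2·weightⁿ = large }
  where
  -- Because 2ˢ ≥ s, this choice avoids logarithms. The added 1 gives 2ˢ ≥ suc k even for n = 0, so
  -- that q is at least 1.
  s = (2 ℕ.* n ℕ.+ 1) ℕ.* suc k
  N = 2 ℕ.^ s
  instance
    N≢0 : NonZero N
    N≢0 = ℕₚ.m^n≢0 2 s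
  q = N ℕ./ suc k
  i = ℤ.+ 1 / N
  c = i * ι q
  0≤c : 0ℚ ≤ c
  0≤c = *-nonNeg (0≤1/n N) (0≤ι q)
  s≤N : s ℕ.≤ N
  s≤N = n≤2^n s
  k<N : suc k ℕ.≤ N
  k<N = ℕₚ.≤-trans (ℕₚ.≤-trans (ℕₚ.≤-reflexive (sym (ℕₚ.*-identityˡ (suc k)))) (ℕₚ.*-monoˡ-≤ (suc k) (ℕₚ.m≤n+m 1 (2 ℕ.* n)))) s≤N
  kq≤N : suc k ℕ.* q ℕ.≤ N
  kq≤N = ℕₚ.≤-trans (ℕₚ.≤-reflexive (ℕₚ.*-comm (suc k) q)) (m/n*n≤m N (suc k))
  weight≤′ : ∀ (G : Fin (suc k) → ℚ) → (∀ a → 0ℚ ≤ G a) → c * sumFin (suc k) G ≤ 𝔼 s (λ u → G (block q k s u))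
  weight≤′ G 0≤G = begin
    i * ι q * sumFin (suc k) G ≡⟨ *-assoc i (ι q) _ ⟩
    i * (ι q * sumFin (suc k) G) ≤⟨ *-monoˡ (0≤1/n N) (sumFin≤𝔼-block q k s kq≤N G 0≤G) ⟩
    i * (ι N * e) ≡⟨ sym (*-assoc i (ι N) e) ⟩
    i * ι N * e ≡⟨ cong (_* e) (1/n*ι N) ⟩
    1ℚ * e ≡⟨ *-identityˡ e ⟩
    e ∎
    where
    open ≤-Reasoning
    e = 𝔼 s (λ u → G (block q k s u))
  x = ι (suc k) * c
  -- Here 1 - x is the remainder of N modulo suc k, divided by N. It is at most suc k / N, so
  -- Bernoulli's inequality loses at most one half over n coordinates.
  defect : ι 2 * (ι n * (1ℚ - x)) ≤ 1ℚ
  defect = begin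
    ι 2 * (ι n * (1ℚ - x)) ≡⟨ cong (λ z → ι 2 * (ι n * (z - x))) (sym (1/n*ι N)) ⟩
    ι 2 * (ι n * (i * ι N - ι (suc k) * (i * ι q))) ≡⟨ solve 5 (λ n i N k q → con (ι 2) :* (n :* (i :* N :- k :* (i :* q))) := i :* (con (ι 2) :* n :* (N :- k :* q))) refl (ι n) i (ι N) (ι (suc k)) (ι q) ⟩
    i * (ι 2 * ι n * (ι N - ι (suc k) * ι q)) ≤⟨ *-monoˡ (0≤1/n N) (≤-trans (*-monoˡ (*-nonNeg (0≤ι 2) (0≤ι n)) N-kq≤k) 2nk≤N) ⟩
    i * ι N ≡⟨ 1/n*ι N ⟩
    1ℚ ∎
    where
    open ≤-Reasoning
    N≤ : N ℕ.≤ suc k ℕ.+ q ℕ.* suc k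
    N≤ = ℕₚ.≤-trans (ℕₚ.≤-reflexive (m≡m%n+[m/n]*n N (suc k))) (ℕₚ.+-monoˡ-≤ (q ℕ.* suc k) (ℕₚ.<⇒≤ (m%n<n N (suc k))))
    N-kq≤k : ι N - ι (suc k) * ι q ≤ ι (suc k)
    N-kq≤k = ≤-trans (+-monoˡ-≤ (- (ι (suc k) * ι q)) (≤-trans (ι-mono N≤) (≤-reflexive (trans (ι-+ (suc k) (q ℕ.* suc k)) (cong (ι (suc k) +_) (ι-* q (suc k)))))))
      (≤-reflexive (solve 2 (λ k q → k :+ q :* k :- k :* q := k) refl (ι (suc k)) (ι q)))
    2nk≤N : ι 2 * ι n * ι (suc k) ≤ ι N
    2nk≤N = ≤-trans (≤-reflexive (trans (cong (_* ι (suc k)) (sym (ι-* 2 n))) (sym (ι-* (2 ℕ.* n) (suc k)))))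
      (ι-mono (ℕₚ.≤-trans (ℕₚ.*-monoˡ-≤ (suc k) (ℕₚ.m≤m+n (2 ℕ.* n) 1)) s≤N))
  large : 1ℚ ≤ ι 2 * (pow (ι (suc k)) n * pow c n)
  large = begin
    1ℚ ≤⟨ ≤-excess (1ℚ - ι 2 * (ι n * (1ℚ - x))) (≤⇒0≤- defect)
      (solve 1 (λ z → con 1ℚ :+ (con 1ℚ :- con (ι 2) :* z) := con (ι 2) :* (con 1ℚ :- z)) refl (ι n * (1ℚ - x))) ⟩
    ι 2 * (1ℚ - ι n * (1ℚ - x)) ≤⟨ *-monoˡ (0≤ι 2) (bernoulli x n (*-nonNeg (0≤ι (suc k)) 0≤c)) ⟩
    ι 2 * pow x n ≡⟨ cong (ι 2 *_) (pow-* (ι (suc k)) c n) ⟩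
    ι 2 * (pow (ι (suc k)) n * pow c n) ∎
    where open ≤-Reasoning

-- Approximation by a junta

TwoValued : ∀ {A : Set} → (A → ℚ) → Set
TwoValued h = ∀ x → h x ≡ 0ℚ ⊎ h x ≡ ι 2

-- The cubic identity is what `level-inequality` asks for; the inequality turns squared influences
-- into the absolute variations that a Lipschitz condition controls.
IsSign : ℚ → Set
IsSign g = g * g ² ≡ g × g ² ≤ ∣ g ∣

D-isSign : ∀ a b → a ≡ 0ℚ ⊎ a ≡ ι 2 → b ≡ 0ℚ ⊎ b ≡ ι 2 → IsSign (½ * (a - b))
D-isSign a b (inj₁ refl) (inj₁ refl) = refl , ≤-refl
D-isSign a b (inj₁ refl) (inj₂ refl) = refl , ≤-refl
D-isSign a b (inj₂ refl) (inj₁ refl) = refl , ≤-refl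
D-isSign a b (inj₂ refl) (inj₂ refl) = refl , ≤-refl

τ : ℕ → ℚ
τ d = pow 1/6ℚ d

0≤τ : ∀ d → 0ℚ ≤ τ d
0≤τ = pow-nonNeg (nonNegative⁻¹ 1/6ℚ)

module _ {k n : ℕ} (enc : Encoding k n) where
  open Encoding enc

  line : Fin n → (Cube (suc k) n → Cube (suc k) n → ℚ) → ℚ
  line = lineSum φ n

  𝔼ψ : (Cube (suc k) n → ℚ) → ℚ
  𝔼ψ F = 𝔼 (n ℕ.* s) (λ w → F (ψ φ n w))

  -- The two regimes of the error bound: `poincaré` covers degree 1 for every J, the empty one
  -- included, and `friedgut` covers a J containing all coordinates of large variation.
  Admissible : Subset n → ℕ → (Cube (suc k) n → ℚ) → Set
  Admissible J d h = d ≡ 1 ⊎ (∀ j → lookup J j ≡ false → line j (variation h) ≤ τ d ²)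

  influence≤lineSum : ∀ h → TwoValued h → ∀ j → sumFin s (λ r → ‖ D (combine j r) (λ w → h (ψ φ n w)) ‖²) ≤ line j (variation h)
  influence≤lineSum h h∈ j = ≤-trans (sumFin-mono s (λ r → 𝔼-mono (n ℕ.* s) (λ w → proj₂ (D-isSign _ _ (h∈ _) (h∈ _)))))
    (blockInfluence≤lineSum φ bits≤ n j h)

  junta-error : ∀ h → TwoValued h → ∀ J d → Admissible J d h →
    ι d * 𝔼ψ (λ x → (h x - condCube φ J h x) ²) ≤ ι 2 * sumFin n (λ j → line j (variation h))
  junta-error h h∈ J d adm = begin
    ι d * 𝔼ψ (λ x → (h x - condCube φ J h x) ²) ≡⟨ cong (ι d *_) (𝔼-cong (n ℕ.* s) (λ w → cong (λ z → (f w - z) ²) (sym (cond-blocks φ n J h w)))) ⟩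
    ι d * ‖ f ⊖ cond J′ f ‖² ≤⟨ main adm ⟩
    influence f + influence f ≤⟨ +-mono-≤ total total ⟩
    I + I ≡⟨ solve 1 (λ x → x :+ x := con (ι 2) :* x) refl I ⟩
    ι 2 * I ∎
    where
    open ≤-Reasoning
    f : Fun (n ℕ.* s)
    f w = h (ψ φ n w)
    J′ = blocks φ J
    I = sumFin n (λ j → line j (variation h))
    total : influence f ≤ I
    total = ≤-trans (≤-reflexive (sumFin-combine n s _)) (sumFin-mono n (influence≤lineSum h h∈))
    main : Admissible J d h → ι d * ‖ f ⊖ cond J′ f ‖² ≤ influence f + influence f
    main (inj₁ refl) = ≤-trans (≤-reflexive (*-identityˡ ‖ f ⊖ cond J′ f ‖²)) (poincaré J′ f)
    main (inj₂ small) = friedgut J′ d f (0≤τ d) (threshold≤1 d) (λ j v → proj₁ (D-isSign _ _ (h∈ _) (h∈ _))) small′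
      where
      small′ : ∀ i → lookup J′ i ≡ false → ‖ D i f ‖² ≤ τ d ²
      small′ i eq with combine-surjective {n} {s} i
      -- A single bit has at most the influence of its block, and the block lies outside J together
      -- with the bit.
      ... | j , r , refl = ≤-trans (term≤sumFin s (λ r → 0≤‖‖² (D (combine j r) f)) r)
        (≤-trans (influence≤lineSum h h∈ j) (small j (trans (sym (lookup-blocks φ J j r)) eq)))

  module _ {l : ℕ} (F : Cube (suc k) n → Fin (suc l)) where

    threshold : Fin l → Cube (suc k) n → ℚ
    threshold t x = thr t (F x)

    variationF : Cube (suc k) n → Cube (suc k) n → ℚ
    variationF = variation (λ x → val (F x))

    totalVariation : ℚ
    totalVariation = sumFin n (λ j → line j variationF)

    approximant : Subset n → Cube (suc k) n → Fin (suc l)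
    approximant J x = tally l (λ t → atLeast1 (condCube φ J (threshold t) x))

    approximant-junta : ∀ J x y → (∀ j → j ∈ J → x j ≡ y j) → approximant J x ≡ approximant J y
    approximant-junta J x y eq = tally-cong l (λ t → cong atLeast1
      (condCube-junta φ J (threshold t) x y (λ j j∈ → eq j (lookup⇒[]= j J j∈))))

    sum-line : ∀ j → sumFin l (λ t → line j (variation (threshold t))) ≡ ι 2 * line j variationF
    sum-line j = trans (sym (lineSum-sumFin φ n j l _)) (trans
      (≤-antisym (lineSum-mono φ n j (λ x y → ≤-reflexive (sum-thr-variation l (F x) (F y))))
                 (lineSum-mono φ n j (λ x y → ≤-reflexive (sym (sum-thr-variation l (F x) (F y))))))
      (lineSum-* φ n j (ι 2) variationF))

    -- One term is bounded by the whole co-area sum. A set J chosen from the variation of F alone is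
    -- thereby admissible for all thresholds at once.
    line-threshold≤ : ∀ j t → line j (variation (threshold t)) ≤ ι 2 * line j variationF
    line-threshold≤ j t = ≤-trans (term≤sumFin l (λ t → 0≤lineSum φ n j (λ x y → 0≤∣p∣ (threshold t x - threshold t y))) t) (≤-reflexive (sum-line j))

    -- The 4 is 2 · 2: low and high degrees each contribute one influence, and the thresholds have
    -- height 2.
    approximant-error : ∀ J d → (∀ t → Admissible J d (threshold t)) →
      ι d * 𝔼ψ (λ x → ∣ val (F x) - val (approximant J x) ∣) ≤ ι 4 * totalVariation
    approximant-error J d adm = begin
      ι d * 𝔼ψ (λ x → ∣ val (F x) - val (approximant J x) ∣) ≤⟨ *-monoˡ (0≤ι d) (𝔼-mono (n ℕ.* s) (λ w → rounding l (F (ψ φ n w)) (λ t → condCube φ J (threshold t) (ψ φ n w)))) ⟩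
      ι d * 𝔼ψ (λ x → sumFin l (λ t → (threshold t x - condCube φ J (threshold t) x) ²)) ≡⟨ cong (ι d *_) (𝔼-sumFin (n ℕ.* s) l _) ⟩
      ι d * sumFin l (λ t → 𝔼ψ (λ x → (threshold t x - condCube φ J (threshold t) x) ²)) ≡⟨ sym (sumFin-* l (ι d) _) ⟩
      sumFin l (λ t → ι d * 𝔼ψ (λ x → (threshold t x - condCube φ J (threshold t) x) ²)) ≤⟨ sumFin-mono l (λ t → junta-error (threshold t) (λ x → thr-two t (F x)) J d (adm t)) ⟩
      sumFin l (λ t → ι 2 * sumFin n (λ j → line j (variation (threshold t)))) ≡⟨ sumFin-* l (ι 2) _ ⟩
      ι 2 * sumFin l (λ t → sumFin n (λ j → line j (variation (threshold t)))) ≡⟨ cong (ι 2 *_) (sumFin-comm l n _) ⟩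
      ι 2 * sumFin n (λ j → sumFin l (λ t → line j (variation (threshold t)))) ≡⟨ cong (ι 2 *_) (sumFin-cong n sum-line) ⟩
      ι 2 * sumFin n (λ j → ι 2 * line j variationF) ≡⟨ cong (ι 2 *_) (sumFin-* n (ι 2) _) ⟩
      ι 2 * (ι 2 * totalVariation) ≡⟨ solve 1 (λ x → con (ι 2) :* (con (ι 2) :* x) := con (ι 4) :* x) refl totalVariation ⟩
      ι 4 * totalVariation ∎
      where open ≤-Reasoning

  -- Here i is the normalisation (suc k)⁻ⁿ, characterised by its product. The factor 2 is the price
  -- of domination by only half of the measure.
  sumCube≤2𝔼ψ : ∀ F → (∀ x → 0ℚ ≤ F x) → (∀ x y → (∀ i → x i ≡ y i) → F x ≡ F y) →
    ∀ i → 0ℚ ≤ i → i * ι (suc k ℕ.^ n) ≡ 1ℚ → i * sumCube (suc k) n F ≤ ι 2 * 𝔼ψ F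
  sumCube≤2𝔼ψ F 0≤F ext i 0≤i i≡ = begin
    i * S ≡⟨ solve 2 (λ i s → i :* s := con 1ℚ :* (i :* s)) refl i S ⟩
    1ℚ * (i * S) ≤⟨ *-monoʳ (*-nonNeg 0≤i (sumCube-nonNeg n F 0≤F)) 1≤2·weightⁿ ⟩
    ι 2 * (pow (ι (suc k)) n * W) * (i * S) ≡⟨ solve 4 (λ p w i s → con (ι 2) :* (p :* w) :* (i :* s) := con (ι 2) :* (i :* p) :* (w :* s)) refl (pow (ι (suc k)) n) W i S ⟩
    ι 2 * (i * pow (ι (suc k)) n) * (W * S) ≡⟨ cong (λ z → ι 2 * z * (W * S)) (trans (cong (i *_) (sym (ι-^ (suc k) n))) i≡) ⟩
    ι 2 * 1ℚ * (W * S) ≤⟨ *-monoˡ (0≤ι 2) (sumCube≤𝔼 φ 0≤weight weight≤ n F 0≤F ext) ⟩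
    ι 2 * 𝔼ψ F ∎
    where
    open ≤-Reasoning
    S = sumCube (suc k) n F
    W = pow weight n
    sumCube-nonNeg : ∀ n F → (∀ x → 0ℚ ≤ F x) → 0ℚ ≤ sumCube (suc k) n F
    sumCube-nonNeg zero F 0≤F = 0≤F _
    sumCube-nonNeg (suc n) F 0≤F = sumFin-nonNeg (suc k) (λ a → sumCube-nonNeg n _ (λ x → 0≤F (a ∷ᶠ x)))

sumCube≤ : ∀ k n F c → (∀ x → F x ≤ c) → sumCube k n F ≤ ι (k ℕ.^ n) * c
sumCube≤ k zero F c le = ≤-trans (le _) (≤-reflexive (sym (*-identityˡ c)))
sumCube≤ k (suc n) F c le = ≤-trans (sumFin-mono k (λ a → sumCube≤ k n _ c (λ x → le (a ∷ᶠ x))))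
  (≤-reflexive (trans (sumFin-const k (ι (k ℕ.^ n) * c)) (trans (sym (*-assoc (ι k) _ c)) (cong (_* c) (sym (ι-* k (k ℕ.^ n)))))))

-- Rounding up to a degree, and partial sums of the exponential series

natCeiling : ∀ x D → 0ℚ < x → x ≤ ι D → ∃ λ d → x ≤ ι (suc d) × ι d < x
natCeiling x zero 0<x x≤ = ⊥-elim (<-irrefl refl (<-≤-trans 0<x x≤))
natCeiling x (suc D) 0<x x≤ with x ≤? ι D
... | yes x≤D = natCeiling x D 0<x x≤D
... | no x≰D = D , x≤ , ≰⇒> x≰D

archimedean : ∀ x → ∃ λ D → x ≤ ι D
archimedean x@(mkℚ p d _) = ℤ.∣ p ∣ , toℚᵘ-cancel-≤ (ℚᵘₚ.≤-respʳ-≃ (ℚᵘₚ.≃-sym (toℚᵘ-fromℚᵘ (ℚᵘ.mkℚᵘ (ℤ.+ ℤ.∣ p ∣) 0))) (ℚᵘ.*≤* le))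
  where
  le : p ℤ.* ℤ.+ 1 ℤ.≤ ℤ.+ ℤ.∣ p ∣ ℤ.* ℤ.+ suc d
  le = ℤₚ.≤-trans (ℤₚ.≤-reflexive (ℤₚ.*-identityʳ p)) (ℤₚ.≤-trans (p≤∣p∣ p)
    (ℤₚ.≤-trans (ℤ.+≤+ (ℕₚ.m≤m*n ℤ.∣ p ∣ (suc d))) (ℤₚ.≤-reflexive (ℤₚ.pos-* ℤ.∣ p ∣ (suc d)))))
    where
    p≤∣p∣ : ∀ p → p ℤ.≤ ℤ.+ ℤ.∣ p ∣
    p≤∣p∣ (ℤ.+ _) = ℤₚ.≤-refl
    p≤∣p∣ ℤ.-[1+ _ ] = ℤ.-≤+

0≤expPartial : ∀ {y} → 0ℚ ≤ y → ∀ N → 0ℚ ≤ expPartial y N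
0≤expPartial 0≤y zero = ≤-refl
0≤expPartial {y} 0≤y (suc N) = +-nonNeg (0≤expPartial 0≤y N) (*-nonNeg (pow-nonNeg 0≤y N) (0≤1/n (N !) {{N ℕₚ.!≢0}}))

factorial*pow≤ : ∀ c d {y} → 0ℚ ≤ c → c * ι d ≤ y → ι (d !) * pow c d ≤ pow y d
factorial*pow≤ c zero 0≤c le = ≤-refl
factorial*pow≤ c (suc d) {y} 0≤c le = begin
  ι (suc d ℕ.* d !) * (c * pow c d) ≡⟨ cong (_* (c * pow c d)) (ι-* (suc d) (d !)) ⟩
  ι (suc d) * ι (d !) * (c * pow c d) ≡⟨ solve 4 (λ a b c p → a :* b :* (c :* p) := c :* a :* (b :* p)) refl (ι (suc d)) (ι (d !)) c (pow c d) ⟩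
  c * ι (suc d) * (ι (d !) * pow c d) ≤⟨ *-mono (≤-trans (*-nonNeg 0≤c (0≤ι (suc d))) le) (*-nonNeg (0≤ι (d !)) (pow-nonNeg 0≤c d)) le
    (factorial*pow≤ c d 0≤c (≤-trans (*-monoˡ 0≤c (ι-mono (ℕₚ.n≤1+n d))) le)) ⟩
  y * pow y d ∎
  where open ≤-Reasoning

-- The single term yᵈ/d! of the exponential series already dominates cᵈ when y ≥ c d.
pow≤expPartial : ∀ c d {y} → 0ℚ ≤ c → c * ι d ≤ y → pow c d ≤ expPartial y (suc d)
pow≤expPartial c d {y} 0≤c le = begin
  pow c d ≡⟨ sym (*-identityˡ (pow c d)) ⟩
  1ℚ * pow c d ≡⟨ cong (_* pow c d) (sym (1/n*ι (d !))) ⟩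
  i * ι (d !) * pow c d ≡⟨ *-assoc i (ι (d !)) (pow c d) ⟩
  i * (ι (d !) * pow c d) ≤⟨ *-monoˡ (0≤1/n (d !)) (factorial*pow≤ c d 0≤c le) ⟩
  i * pow y d ≤⟨ ≤-excess (expPartial y d) (0≤expPartial 0≤y d) (solve 3 (λ i p e → i :* p :+ e := e :+ p :* i) refl i (pow y d) (expPartial y d)) ⟩
  expPartial y (suc d) ∎
  where
  open ≤-Reasoning
  instance
    d!≢0 : NonZero (d !)
    d!≢0 = d ℕₚ.!≢0
  i = ℤ.+ 1 / (d !)
  0≤y : 0ℚ ≤ y
  0≤y = ≤-trans (*-nonNeg 0≤c (0≤ι d)) le

module _ {k n : ℕ} .{{_ : NonZero n}} (enc : Encoding k n) {l : ℕ} (F : Cube (suc k) n → Fin (suc l))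
  (F-ext : ∀ x y → (∀ i → x i ≡ y i) → val (F x) ≡ val (F y)) where

  Approximation : ℚ → ℚ → Set
  Approximation ε Y = Σ ℕ λ M → Σ (Cube (suc k) n → Fin (suc l)) λ g →
    Junta M g × Close (suc k) n ε F g × ι M ≤ ι l ·exp Y

  error : (Cube (suc k) n → Fin (suc l)) → Cube (suc k) n → ℚ
  error g x = ∣ val (F x) - val (g x) ∣

  instance
    kⁿ≢0 : NonZero (suc k ℕ.^ n)
    kⁿ≢0 = ℕₚ.m^n≢0 (suc k) n

  -- All values lie within `l` of the least one. Disposing of this case leaves ε < `l`, which later
  -- produces the prefactor of the exponential. With M = 0 the empty partial sum is a sufficient
  -- witness.
  constant-approximation : ∀ {ε} Y → ι l ≤ ε → Approximation ε Y
  constant-approximation {ε} Y l≤ε = 0 , (λ _ → F.zero) , (⊥ , ∣⊥∣≡0 n , λ _ _ _ → refl) , close ,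
    (0 , ≤-reflexive (sym (*-zeroʳ (ι l))))
    where
    i = ℤ.+ 1 / (suc k ℕ.^ n)
    close : i * sumCube (suc k) n (error (λ _ → F.zero)) ≤ ε
    close = begin
      i * sumCube (suc k) n (error (λ _ → F.zero)) ≤⟨ *-monoˡ (0≤1/n (suc k ℕ.^ n)) (sumCube≤ (suc k) n _ ε (λ x →
        ≤-trans (≤-reflexive (trans (cong ∣_∣ (+-identityʳ (val (F x)))) (0≤p⇒∣p∣≡p (0≤ι (toℕ (F x))))))
          (≤-trans (ι-mono (toℕ≤pred[n] (F x))) l≤ε))) ⟩
      i * (ι (suc k ℕ.^ n) * ε) ≡⟨ sym (*-assoc i _ ε) ⟩
      i * ι (suc k ℕ.^ n) * ε ≡⟨ cong (_* ε) (1/n*ι (suc k ℕ.^ n)) ⟩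
      1ℚ * ε ≡⟨ *-identityˡ ε ⟩
      ε ∎
      where open ≤-Reasoning

  module _ {X ε : ℚ} (0<ε : 0ℚ < ε) (variation≤ : totalVariation enc F ≤ X * ε) where

    -- The 8 is 2 · 4: the comparison of measures times the constant of `approximant-error`.
    approximant-close : ∀ J d → ι 8 * X ≤ ι (suc d) → (∀ t → Admissible enc J (suc d) (threshold enc F t)) →
      Close (suc k) n ε F (approximant enc F J)
    approximant-close J d 8X≤d adm = *-cancelˡ-≤-pos (ι (suc d)) {{positive (0<ι (suc d))}} (begin
      ι (suc d) * (i * sumCube (suc k) n (error g)) ≤⟨ *-monoˡ (0≤ι (suc d)) (sumCube≤2𝔼ψ enc (error g) (λ x → 0≤∣p∣ _) ext i (0≤1/n (suc k ℕ.^ n)) (1/n*ι (suc k ℕ.^ n))) ⟩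
      ι (suc d) * (ι 2 * e) ≡⟨ solve 2 (λ d e → d :* (con (ι 2) :* e) := con (ι 2) :* (d :* e)) refl (ι (suc d)) e ⟩
      ι 2 * (ι (suc d) * e) ≤⟨ *-monoˡ (0≤ι 2) (approximant-error enc F J (suc d) adm) ⟩
      ι 2 * (ι 4 * totalVariation enc F) ≤⟨ *-monoˡ (0≤ι 2) (*-monoˡ (0≤ι 4) variation≤) ⟩
      ι 2 * (ι 4 * (X * ε)) ≡⟨ solve 2 (λ x e → con (ι 2) :* (con (ι 4) :* (x :* e)) := con (ι 8) :* x :* e) refl X ε ⟩
      ι 8 * X * ε ≤⟨ *-monoʳ (<⇒≤ 0<ε) 8X≤d ⟩
      ι (suc d) * ε ∎)
      where
      open ≤-Reasoning
      i = ℤ.+ 1 / (suc k ℕ.^ n)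
      g = approximant enc F J
      e = 𝔼ψ enc (error g)
      ext : ∀ x y → (∀ i → x i ≡ y i) → error g x ≡ error g y
      ext x y x≡y = cong₂ (λ a b → ∣ a - b ∣) (F-ext x y x≡y) (cong val (approximant-junta enc F J x y (λ j _ → x≡y j)))

    approximate : ∀ Y → 0ℚ < X → Y ≡ ι 1152 * X → Approximation ε Y
    approximate Y 0<X Y≡ with ι l ≤? ε
    ... | yes l≤ε = constant-approximation Y l≤ε
    ... | no l≰ε = byDegree (natCeiling (ι 8 * X) (proj₁ arch) 0<8X (proj₂ arch))
      where
      arch = archimedean (ι 8 * X)
      0<8X : 0ℚ < ι 8 * X
      0<8X = subst (_< ι 8 * X) (*-zeroʳ (ι 8)) (*-monoʳ-<-pos (ι 8) 0<X)
      byDegree : (∃ λ d → ι 8 * X ≤ ι (suc d) × ι d < ι 8 * X) → Approximation ε Y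
      -- Degree 1 comes with no positive lower bound on X, so exp Y may be arbitrarily close to 1
      -- and cannot pay for a set of large coordinates; the empty J is used instead.
      byDegree (zero , 8X≤1 , _) = 0 , approximant enc F ⊥ , (⊥ , ∣⊥∣≡0 n , approximant-junta enc F ⊥) ,
        approximant-close ⊥ 0 8X≤1 (λ t → inj₁ refl) , (0 , ≤-reflexive (sym (*-zeroʳ (ι l))))
      byDegree (suc d′ , 8X≤d , d-1<8X) = size J , approximant enc F J , (J , refl , approximant-junta enc F J) ,
        approximant-close J (suc d′) 8X≤d (λ t → inj₂ (λ j j∉J → ≤-trans (line-threshold≤ enc F j t) (exceeding-false n w (τ d ²) j j∉J))) ,
        (suc d , size≤)
        where
        open ≤-Reasoning
        d = suc (suc d′)
        w : Fin n → ℚ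
        w j = ι 2 * line enc j (variationF enc F)
        J = exceeding n w (τ d ²)
        T = pow 6ℚ d
        Tτ≡1 : T * τ d ≡ 1ℚ
        Tτ≡1 = trans (sym (pow-* 6ℚ 1/6ℚ d)) (pow-1 d)
        0≤X : 0ℚ ≤ X
        0≤X = <⇒≤ 0<X
        0≤T² : 0ℚ ≤ T ²
        0≤T² = 0≤² T
        2X≤d : ι 2 * X ≤ ι d
        2X≤d = ≤-trans (*-monoʳ 0≤X (ι-mono {2} {8} (s≤s (s≤s z≤n)))) 8X≤d
        -- d ≤ 2 (d - 1) < 16 X, and |J| ≤ 2 X ε 36ᵈ ≤ l d 36ᵈ ≤ l 72ᵈ; hence 1152 = 16 · 72.
        72d≤Y : ι 72 * ι d ≤ Y
        72d≤Y = begin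
          ι 72 * ι d ≤⟨ *-monoˡ (0≤ι 72) (ι-mono {d} {2 ℕ.* suc d′} (ℕₚ.≤-trans (s≤s (s≤s (ℕₚ.m≤m+n d′ (d′ ℕ.+ 0)))) (ℕₚ.≤-reflexive (cong suc (sym (ℕₚ.+-suc d′ (d′ ℕ.+ 0))))))) ⟩
          ι 72 * ι (2 ℕ.* suc d′) ≡⟨ cong (ι 72 *_) (ι-* 2 (suc d′)) ⟩
          ι 72 * (ι 2 * ι (suc d′)) ≤⟨ *-monoˡ (0≤ι 72) (*-monoˡ (0≤ι 2) (<⇒≤ d-1<8X)) ⟩
          ι 72 * (ι 2 * (ι 8 * X)) ≡⟨ solve 1 (λ x → con (ι 72) :* (con (ι 2) :* (con (ι 8) :* x)) := con (ι 1152) :* x) refl X ⟩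
          ι 1152 * X ≡⟨ sym Y≡ ⟩
          Y ∎
        size≤ : ι (size J) ≤ ι l * expPartial Y (suc d)
        size≤ = begin
          -- Inserting (T τ)² = 1 takes the place of dividing Markov's inequality by τ².
          ι (size J) ≡⟨ trans (solve 1 (λ x → x := x :* (con 1ℚ :* con 1ℚ)) refl (ι (size J))) (cong (λ z → ι (size J) * (z * z)) (sym Tτ≡1)) ⟩
          ι (size J) * ((T * τ d) * (T * τ d)) ≡⟨ solve 3 (λ s t u → s :* (t :* u :* (t :* u)) := s :* (u :* u) :* (t :* t)) refl (ι (size J)) T (τ d) ⟩
          ι (size J) * τ d ² * T ² ≤⟨ *-monoʳ 0≤T² (markov n w (τ d ²) (λ j → *-nonNeg (0≤ι 2) (0≤lineSum (Encoding.φ enc) n j (λ x y → 0≤∣p∣ _)))) ⟩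
          sumFin n w * T ² ≡⟨ cong (_* T ²) (sumFin-* n (ι 2) _) ⟩
          ι 2 * totalVariation enc F * T ² ≤⟨ *-monoʳ 0≤T² (*-monoˡ (0≤ι 2) variation≤) ⟩
          -- Here ε is traded for `l`, the number of thresholds, by the failure of the constant
          -- case.
          ι 2 * (X * ε) * T ² ≤⟨ *-monoʳ 0≤T² (*-monoˡ (0≤ι 2) (*-monoˡ 0≤X (<⇒≤ (≰⇒> l≰ε)))) ⟩
          ι 2 * (X * ι l) * T ² ≡⟨ solve 3 (λ x l t → con (ι 2) :* (x :* l) :* t := l :* (con (ι 2) :* x :* t)) refl X (ι l) (T ²) ⟩
          ι l * (ι 2 * X * T ²) ≤⟨ *-monoˡ (0≤ι l) (*-monoʳ 0≤T² (≤-trans 2X≤d (ι≤pow2 d))) ⟩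
          ι l * (pow (ι 2) d * T ²) ≡⟨ cong (ι l *_) (trans (cong (pow (ι 2) d *_) (sym (pow-* 6ℚ 6ℚ d))) (sym (pow-* (ι 2) (6ℚ * 6ℚ) d))) ⟩
          ι l * pow (ι 72) d ≤⟨ *-monoˡ (0≤ι l) (pow≤expPartial (ι 72) d (0≤ι 72) 72d≤Y) ⟩
          ι l * expPartial Y (suc d) ∎

-- Components of a Lipschitz map

∣a-b∣≤0⇒a≡b : ∀ a b → ∣ a - b ∣ ≤ 0ℚ → a ≡ b
∣a-b∣≤0⇒a≡b a b le = trans (solve 2 (λ a b → a := a :- b :+ b) refl a b)
  (trans (cong (_+ b) (∣p∣≡0⇒p≡0 (a - b) (≤-antisym le (0≤∣p∣ (a - b))))) (+-identityˡ b))

module _ {k l n m : ℕ} .{{_ : NonZero n}} .{{_ : NonZero m}} {α : ℚ} (0≤α : 0ℚ ≤ α)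
  (f : Cube (suc k) n → Cube (suc l) m) (lip : Lipschitz n m α f) where

  coordinate : Fin m → Cube (suc k) n → Fin (suc l)
  coordinate i x = f x i

  slope : ℚ
  slope = ι m * (α * (ℤ.+ 1 / n))

  sum-variation≤ : ∀ x y → sumFin m (λ i → ∣ val (f x i) - val (f y i) ∣) ≤ slope * ∥ x - y ∥
  sum-variation≤ x y = begin
    V ≡⟨ trans (sym (*-identityˡ V)) (cong (_* V) (sym (1/n*ι m))) ⟩
    i * ι m * V ≡⟨ solve 3 (λ i m v → i :* m :* v := m :* (i :* v)) refl i (ι m) V ⟩
    ι m * (i * V) ≤⟨ *-monoˡ (0≤ι m) (lip x y) ⟩
    ι m * (α * ((ℤ.+ 1 / n) * ∥ x - y ∥)) ≡⟨ solve 4 (λ m a j z → m :* (a :* (j :* z)) := m :* (a :* j) :* z) refl (ι m) α (ℤ.+ 1 / n) ∥ x - y ∥ ⟩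
    slope * ∥ x - y ∥ ∎
    where
    open ≤-Reasoning
    i = ℤ.+ 1 / m
    V = sumFin m (λ i → ∣ val (f x i) - val (f y i) ∣)

  -- Points of the cube are functions, and pointwise equal ones need not be identical. They have
  -- distance 0, however, so the Lipschitz condition itself makes f respect pointwise equality.
  coordinate-ext : ∀ i x y → (∀ j → x j ≡ y j) → val (f x i) ≡ val (f y i)
  coordinate-ext i x y x≡y = ∣a-b∣≤0⇒a≡b _ _ (≤-trans (term≤sumFin m (λ i → 0≤∣p∣ (val (f x i) - val (f y i))) i)
    (≤-trans (sum-variation≤ x y) (≤-reflexive (trans (cong (slope *_) (sumFin-zero n (λ j →
      trans (cong (λ a → ∣ val (x j) - val a ∣) (sym (x≡y j))) (∣a-a∣≡0 (val (x j)))))) (*-zeroʳ slope)))))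

  -- The sum over components is moved inside the line sums, since the Lipschitz condition bounds all
  -- components jointly on each edge. Then n directions with k edges each, at m α / n per edge,
  -- cancel the n.
  sum-totalVariation≤ : (enc : Encoding k n) → sumFin m (λ i → totalVariation enc (coordinate i)) ≤ ι m * (α * ι (suc k))
  sum-totalVariation≤ enc = begin
    sumFin m (λ i → sumFin n (λ j → line enc j (variationF enc (coordinate i)))) ≡⟨ sumFin-comm m n _ ⟩
    sumFin n (λ j → sumFin m (λ i → line enc j (variationF enc (coordinate i)))) ≡⟨ sumFin-cong n (λ j → sym (lineSum-sumFin (Encoding.φ enc) n j m _)) ⟩
    sumFin n (λ j → line enc j (λ x y → sumFin m (λ i → ∣ val (f x i) - val (f y i) ∣))) ≤⟨ sumFin-mono n (λ j → lineSum≤ (Encoding.φ enc) n j _ slope sum-variation≤) ⟩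
    sumFin n (λ _ → ι k * slope) ≡⟨ sumFin-const n (ι k * slope) ⟩
    ι n * (ι k * (ι m * (α * i))) ≡⟨ solve 5 (λ n k m a i → n :* (k :* (m :* (a :* i))) := m :* (a :* k) :* (i :* n)) refl (ι n) (ι k) (ι m) α i ⟩
    ι m * (α * ι k) * (i * ι n) ≡⟨ trans (cong (ι m * (α * ι k) *_) (1/n*ι n)) (*-identityʳ _) ⟩
    ι m * (α * ι k) ≤⟨ *-monoˡ (0≤ι m) (*-monoˡ 0≤α (ι-mono (ℕₚ.n≤1+n k))) ⟩
    ι m * (α * ι (suc k)) ∎
    where
    open ≤-Reasoning
    i = ℤ.+ 1 / n

theorem6 : Σ ℚ λ C₃ → 0ℚ < C₃ ×
    ((k l n m : ℕ) → k ≥ 2 → l ≥ 2 →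
    .{{nzk : NonZero k}} .{{nzn : NonZero n}} .{{nzm : NonZero m}} →
    (α : ℚ) → 0ℚ < α →
    (f : Cube k n → Cube l m) → Lipschitz n m α f →
    (δ ε : ℚ) .{{pδ : Positive δ}} .{{pε : Positive ε}} →
    Σ (Subset m) λ S →
    (1ℚ - δ) * ι m ≤ ι (size S) ×
    (∀ i → i ∈ S →
    Σ ℕ λ M → Σ (Cube k n → Fin l) λ g →
    Junta M g × Close k n ε (λ x → f x i) g ×
    ι M ≤ ι (l Data.Nat.∸ 1) ·exp (_÷_ (_÷_ (C₃ * α * ι k) δ {{pos⇒nonZero δ}}) ε {{pos⇒nonZero ε}})))
theorem6 = ι 1152 , positive⁻¹ (ι 1152) , proof
  where
  proof : (k l n m : ℕ) → k ≥ 2 → l ≥ 2 →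
    .{{nzk : NonZero k}} .{{nzn : NonZero n}} .{{nzm : NonZero m}} →
    (α : ℚ) → 0ℚ < α →
    (f : Cube k n → Cube l m) → Lipschitz n m α f →
    (δ ε : ℚ) .{{pδ : Positive δ}} .{{pε : Positive ε}} →
    Σ (Subset m) λ S →
    (1ℚ - δ) * ι m ≤ ι (size S) ×
    (∀ i → i ∈ S →
    Σ ℕ λ M → Σ (Cube k n → Fin l) λ g →
    Junta M g × Close k n ε (λ x → f x i) g ×
    ι M ≤ ι (l ℕ.∸ 1) ·exp (_÷_ (_÷_ (ι 1152 * α * ι k) δ {{pos⇒nonZero δ}}) ε {{pos⇒nonZero ε}}))
  proof (suc k) (suc l) n m _ _ α 0<α f lip δ ε = S , S-large , good
    where
    instance
      δ≢0 = pos⇒nonZero δ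
      ε≢0 = pos⇒nonZero ε
    enc = encoding k n
    B X : ℚ
    B = α * ι (suc k) * 1/ δ
    X = B * 1/ ε
    v : Fin m → ℚ
    v i = totalVariation enc (λ x → f x i)
    0≤v : ∀ i → 0ℚ ≤ v i
    0≤v i = sumFin-nonNeg n (λ j → 0≤lineSum (Encoding.φ enc) n j (λ x y → 0≤∣p∣ _))
    0<* : ∀ {a b} → 0ℚ < a → 0ℚ < b → 0ℚ < a * b
    0<* {a} {b} 0<a 0<b = subst (_< a * b) (*-zeroʳ a) (*-monoʳ-<-pos a {{positive 0<a}} 0<b)
    0<B : 0ℚ < B
    0<B = 0<* (0<* 0<α (0<ι (suc k))) (positive⁻¹ (1/ δ) {{1/pos⇒pos δ}})
    0<X : 0ℚ < X
    0<X = 0<* 0<B (positive⁻¹ (1/ ε) {{1/pos⇒pos ε}})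
    B≡Xε : B ≡ X * ε
    B≡Xε = sym (trans (*-assoc B (1/ ε) ε) (trans (cong (B *_) (*-inverseˡ ε)) (*-identityʳ B)))
    Bδ≡ : B * δ ≡ α * ι (suc k)
    Bδ≡ = trans (*-assoc (α * ι (suc k)) (1/ δ) δ) (trans (cong (α * ι (suc k) *_) (*-inverseˡ δ)) (*-identityʳ _))
    S = notExceeding m v B
    bad = ι (size (exceeding m v B))
    -- `B` is chosen so that m α k equals m δ B; cancelling `B` in Markov's inequality leaves δ m.
    bad≤ : bad ≤ ι m * δ
    bad≤ = *-cancelʳ-≤-pos B {{positive 0<B}} (begin
      bad * B ≤⟨ markov m v B 0≤v ⟩
      sumFin m v ≤⟨ sum-totalVariation≤ (<⇒≤ 0<α) f lip enc ⟩
      ι m * (α * ι (suc k)) ≡⟨ cong (ι m *_) (sym Bδ≡) ⟩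
      ι m * (B * δ) ≡⟨ solve 3 (λ m b d → m :* (b :* d) := m :* d :* b) refl (ι m) B δ ⟩
      ι m * δ * B ∎)
      where open ≤-Reasoning
    S-large : (1ℚ - δ) * ι m ≤ ι (size S)
    S-large = ≤-excess (ι m * δ - bad) (≤⇒0≤- bad≤) (begin
      (1ℚ - δ) * ι m + (ι m * δ - bad) ≡⟨ solve 3 (λ d m b → (con 1ℚ :- d) :* m :+ (m :* d :- b) := m :- b) refl δ (ι m) bad ⟩
      ι m - bad ≡⟨ cong (λ z → ι z - bad) (sym (size-exceeding+notExceeding m v B)) ⟩
      ι (size (exceeding m v B) ℕ.+ size S) - bad ≡⟨ cong (_- bad) (ι-+ (size (exceeding m v B)) (size S)) ⟩
      bad + ι (size S) - bad ≡⟨ solve 2 (λ b s → b :+ s :- b := s) refl bad (ι (size S)) ⟩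
      ι (size S) ∎)
      where open ≡-Reasoning
    good : ∀ i → i ∈ S → Approximation enc (λ x → f x i) (coordinate-ext (<⇒≤ 0<α) f lip i) ε ((ι 1152 * α * ι (suc k)) ÷ δ ÷ ε)
    good i i∈S = approximate enc (λ x → f x i) (coordinate-ext (<⇒≤ 0<α) f lip i) (positive⁻¹ ε)
      (≤-trans (notExceeding-true m v B i ([]=⇒lookup i∈S)) (≤-reflexive B≡Xε)) _ 0<X
      (solve 4 (λ a k d e → con (ι 1152) :* a :* k :* d :* e := con (ι 1152) :* (a :* k :* d :* e)) refl α (ι (suc k)) (1/ δ) (1/ ε))
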